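{- There is no algorithm that guarantees asynchronous rendezvous of arbitrary agents starting from arbitrary points in the (empty) plane $\mathbb{R}^2$. That is, for every algorithm $\mathcal{A}$ for agents in the plane, there exist two distinct labels $\ell_1,\ell_2$, two distinct starting points $v,w\in\mathbb{R}^2$, a walk $f$ on the route of the agent with label $\ell_1$ starting at $v$, and a walk $g$ on the route of the agent with label $\ell_2$ starting at $w$, such that $f(t)\neq g(t)$ for all times $t\ge 0$.
   Context: Agents are points with labels that are positive integers; each agent knows its own label only. The terrain is the whole plane (no boundary). Agents have a compass and a common unit of length, so their coordinate systems are aligned, but the origin of each agent's system is its own starting point; an agent does not know its absolute position and sees nothing around it. The route of an agent is constructed in stages: in each stage the agent chooses a direction and a distance and the corresponding segment is appended to the route. The route does not depend on the walk chosen by the adversary. Thus an algorithm $\mathcal{A}$ for the plane assigns to each label $\ell$ an infinite sequence of vectors $(f^{\ell}_1,f^{\ell}_2,\dots)$ in $\mathbb{R}^2$, and the route of the agent with label $\ell$ starting at $a_1$ is the sequence of segments $[a_m,a_{m+1}]$, $m\geq 1$, where $a_{m+1}=a_m+f^{\ell}_m$ (so routes of the same label from different starting points are translates of each other). A walk on a route $([a_m,a_{m+1}])_{m\ge1}$ (chosen by the adversary) is a function $f:[0,\infty)\to\mathbb{R}^2$ obtained as follows: choose an increasing sequence of reals $t_1=0<t_2<\cdots$ tending to infinity and continuous functions $f_m:[t_m,t_{m+1}]\to[a_m,a_{m+1}]$ (into the segment) with $f_m(t_m)=a_m$, $f_m(t_{m+1})=a_{m+1}$, and put $f(t)=f_m(t)$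 for $t\in[t_m,t_{m+1}]$. -}

module Defs where

open import Data.Nat as ℕ using (ℕ; zero; suc; _⊔_)
import Data.Nat.Properties as ℕₚ
open import Data.Rational as ℚ using (ℚ; 0ℚ; 1ℚ; ½)
import Data.Rational.Properties as ℚₚ
open import Data.Rational.Solver using (module +-*-Solver)
open import Data.Product using (∃; ∃-syntax; _×_; _,_; proj₁; proj₂)
open import Data.Sum using (inj₁; inj₂)
open import Data.Refinement using (Refinement-syntax)
open import Relation.Nullary using (¬_)
open import Relation.Binary.PropositionalEquality
  using (_≡_; refl; sym; trans; cong; subst; subst₂)

Cauchy : (ℕ → ℚ) → Set
Cauchy x = ∀ ε → 0ℚ ℚ.< ε →
  ∃[ N ] (∀ m n → N ℕ.≤ m → N ℕ.≤ n → ℚ.∣ x m ℚ.- x n ∣ ℚ.< ε)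

-- Abstract so that moduli of convergence are never unfolded during typechecking.
abstract

  half-pos : ∀ {ε} → 0ℚ ℚ.< ε → 0ℚ ℚ.< ½ ℚ.* ε
  half-pos {ε} 0<ε = subst (ℚ._< ½ ℚ.* ε) (ℚₚ.*-zeroʳ ½) (ℚₚ.*-monoʳ-<-pos ½ 0<ε)

  half+half : ∀ ε → ½ ℚ.* ε ℚ.+ ½ ℚ.* ε ≡ ε
  half+half ε = trans (sym (ℚₚ.*-distribʳ-+ ε ½ ½)) (ℚₚ.*-identityˡ ε)

  const-cauchy : ∀ q → Cauchy (λ _ → q)
  const-cauchy q ε 0<ε = 0 , λ _ _ _ _ →
    subst (λ z → ℚ.∣ z ∣ ℚ.< ε) (sym (ℚₚ.+-inverseʳ q)) 0<ε

  +-cauchy : ∀ {x y} → Cauchy x → Cauchy y → Cauchy (λ n → x n ℚ.+ y n)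
  +-cauchy {x} {y} cx cy ε 0<ε with cx (½ ℚ.* ε) (half-pos 0<ε) | cy (½ ℚ.* ε) (half-pos 0<ε)
  ... | M , hM | N , hN = M ⊔ N , λ m n m≥ n≥ → begin-strict
      ℚ.∣ x m ℚ.+ y m ℚ.- (x n ℚ.+ y n) ∣
        ≡⟨ cong ℚ.∣_∣ (regroup (x m) (y m) (x n) (y n)) ⟩
      ℚ.∣ (x m ℚ.- x n) ℚ.+ (y m ℚ.- y n) ∣
        ≤⟨ ℚₚ.∣p+q∣≤∣p∣+∣q∣ (x m ℚ.- x n) (y m ℚ.- y n) ⟩
      ℚ.∣ x m ℚ.- x n ∣ ℚ.+ ℚ.∣ y m ℚ.- y n ∣
        <⟨ ℚₚ.+-mono-< (hM m n (ℕₚ.m⊔n≤o⇒m≤o M N m≥) (ℕₚ.m⊔n≤o⇒m≤o M N n≥))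
                       (hN m n (ℕₚ.m⊔n≤o⇒n≤o M N m≥) (ℕₚ.m⊔n≤o⇒n≤o M N n≥)) ⟩
      ½ ℚ.* ε ℚ.+ ½ ℚ.* ε ≡⟨ half+half ε ⟩
      ε ∎
    where
    open ℚₚ.≤-Reasoning
    open +-*-Solver
    regroup : ∀ a b c d → a ℚ.+ b ℚ.- (c ℚ.+ d) ≡ (a ℚ.- c) ℚ.+ (b ℚ.- d)
    regroup = solve 4 (λ a b c d → a :+ b :- (c :+ d) := (a :- c) :+ (b :- d)) refl

  neg-cauchy : ∀ {x} → Cauchy x → Cauchy (λ n → ℚ.- x n)
  neg-cauchy {x} cx ε 0<ε with cx ε 0<ε
  ... | N , h = N , λ m n m≥ n≥ →
    subst (ℚ._< ε)
      (trans (sym (ℚₚ.∣-p∣≡∣p∣ (x m ℚ.- x n))) (cong ℚ.∣_∣ (ℚₚ.neg-distrib-+ (x m) (ℚ.- x n))))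
      (h m n m≥ n≥)

  ∣p∣≤∣p-q∣+∣q∣ : ∀ p q → ℚ.∣ p ∣ ℚ.≤ ℚ.∣ p ℚ.- q ∣ ℚ.+ ℚ.∣ q ∣
  ∣p∣≤∣p-q∣+∣q∣ p q =
    subst (λ z → ℚ.∣ z ∣ ℚ.≤ ℚ.∣ p ℚ.- q ∣ ℚ.+ ℚ.∣ q ∣)
      (solve 2 (λ a b → (a :- b) :+ b := a) refl p q)
      (ℚₚ.∣p+q∣≤∣p∣+∣q∣ (p ℚ.- q) q)
    where open +-*-Solver

  ∣p∣-∣q∣≤∣p-q∣ : ∀ p q → ℚ.∣ p ∣ ℚ.- ℚ.∣ q ∣ ℚ.≤ ℚ.∣ p ℚ.- q ∣
  ∣p∣-∣q∣≤∣p-q∣ p q = begin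
      ℚ.∣ p ∣ ℚ.- ℚ.∣ q ∣
        ≤⟨ ℚₚ.+-monoˡ-≤ (ℚ.- ℚ.∣ q ∣) (∣p∣≤∣p-q∣+∣q∣ p q) ⟩
      ℚ.∣ p ℚ.- q ∣ ℚ.+ ℚ.∣ q ∣ ℚ.- ℚ.∣ q ∣
        ≡⟨ solve 2 (λ a b → a :+ b :- b := a) refl ℚ.∣ p ℚ.- q ∣ ℚ.∣ q ∣ ⟩
      ℚ.∣ p ℚ.- q ∣ ∎
    where
    open ℚₚ.≤-Reasoning
    open +-*-Solver

  ∣p-q∣≡∣q-p∣ : ∀ p q → ℚ.∣ p ℚ.- q ∣ ≡ ℚ.∣ q ℚ.- p ∣
  ∣p-q∣≡∣q-p∣ p q = trans (sym (ℚₚ.∣-p∣≡∣p∣ (p ℚ.- q)))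
    (cong ℚ.∣_∣ (solve 2 (λ a b → :- (a :- b) := b :- a) refl p q))
    where open +-*-Solver

  ∣∣p∣-∣q∣∣≤∣p-q∣ : ∀ p q → ℚ.∣ ℚ.∣ p ∣ ℚ.- ℚ.∣ q ∣ ∣ ℚ.≤ ℚ.∣ p ℚ.- q ∣
  ∣∣p∣-∣q∣∣≤∣p-q∣ p q with ℚₚ.∣p∣≡p∨∣p∣≡-p (ℚ.∣ p ∣ ℚ.- ℚ.∣ q ∣)
  ... | inj₁ eq = subst (ℚ._≤ ℚ.∣ p ℚ.- q ∣) (sym eq) (∣p∣-∣q∣≤∣p-q∣ p q)
  ... | inj₂ eq =
    subst₂ ℚ._≤_
      (trans (solve 2 (λ a b → b :- a := :- (a :- b)) refl ℚ.∣ p ∣ ℚ.∣ q ∣) (sym eq))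
      (∣p-q∣≡∣q-p∣ q p)
      (∣p∣-∣q∣≤∣p-q∣ q p)
    where open +-*-Solver

  abs-cauchy : ∀ {x} → Cauchy x → Cauchy (λ n → ℚ.∣ x n ∣)
  abs-cauchy {x} cx ε 0<ε with cx ε 0<ε
  ... | N , h = N , λ m n m≥ n≥ →
    ℚₚ.≤-<-trans (∣∣p∣-∣q∣∣≤∣p-q∣ (x m) (x n)) (h m n m≥ n≥)

  bounded : ∀ {x} → Cauchy x →
    ∃[ B ] 0ℚ ℚ.< B × ∃[ N ] (∀ n → N ℕ.≤ n → ℚ.∣ x n ∣ ℚ.≤ B)
  bounded {x} cx with cx 1ℚ (ℚₚ.positive⁻¹ 1ℚ)
  ... | N , h = 1ℚ ℚ.+ ℚ.∣ x N ∣
      , ℚₚ.+-mono-<-≤ (ℚₚ.positive⁻¹ 1ℚ) (ℚₚ.0≤∣p∣ (x N))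
      , N
      , λ n n≥ → ℚₚ.≤-trans (∣p∣≤∣p-q∣+∣q∣ (x n) (x N))
          (ℚₚ.+-monoˡ-≤ ℚ.∣ x N ∣ (ℚₚ.<⇒≤ (h n N n≥ ℕₚ.≤-refl)))

  shrink : ∀ C ε → 0ℚ ℚ.< C → 0ℚ ℚ.< ε →
    ∃[ δ ] 0ℚ ℚ.< δ × C ℚ.* δ ℚ.+ C ℚ.* δ ≡ ε
  shrink C ε 0<C 0<ε = go (C ℚ.+ C) refl (ℚ.positive (ℚₚ.+-mono-< 0<C 0<C)) (ℚ.positive 0<ε)
    where
    open +-*-Solver
    rearrange : ∀ c e i → c ℚ.* (e ℚ.* i) ℚ.+ c ℚ.* (e ℚ.* i) ≡ e ℚ.* (i ℚ.* (c ℚ.+ c))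
    rearrange = solve 3 (λ c e i → c :* (e :* i) :+ c :* (e :* i) := e :* (i :* (c :+ c))) refl
    go : ∀ D → D ≡ C ℚ.+ C → ℚ.Positive D → ℚ.Positive ε →
      ∃[ δ ] 0ℚ ℚ.< δ × C ℚ.* δ ℚ.+ C ℚ.* δ ≡ ε
    go D D≡ posD posε = ε ℚ.* i , 0<εi , Cδ+Cδ≡ε
      where
      instance
        nzD : ℚ.NonZero D
        nzD = ℚₚ.pos⇒nonZero D {{posD}}
      i : ℚ
      i = ℚ.1/ D
      0<εi : 0ℚ ℚ.< ε ℚ.* i
      0<εi = ℚₚ.positive⁻¹ (ε ℚ.* i) {{ℚₚ.pos*pos⇒pos ε {{posε}} i {{ℚₚ.1/pos⇒pos D {{posD}}}}}}
      Cδ+Cδ≡ε : C ℚ.* (ε ℚ.* i) ℚ.+ C ℚ.* (ε ℚ.* i) ≡ ε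
      Cδ+Cδ≡ε = trans (rearrange C ε i)
        (trans (cong (λ z → ε ℚ.* (i ℚ.* z)) (sym D≡))
          (trans (cong (ε ℚ.*_) (ℚₚ.*-inverseˡ D)) (ℚₚ.*-identityʳ ε)))

  ∣p*q∣<C*δ : ∀ p q {C δ} → 0ℚ ℚ.< C → ℚ.∣ p ∣ ℚ.≤ C → ℚ.∣ q ∣ ℚ.< δ → ℚ.∣ p ℚ.* q ∣ ℚ.< C ℚ.* δ
  ∣p*q∣<C*δ p q {C} {δ} 0<C p≤C q<δ = begin-strict
    ℚ.∣ p ℚ.* q ∣        ≡⟨ ℚₚ.∣p*q∣≡∣p∣*∣q∣ p q ⟩
    ℚ.∣ p ∣ ℚ.* ℚ.∣ q ∣  ≤⟨ ℚₚ.*-monoʳ-≤-nonNeg ℚ.∣ q ∣ {{ℚₚ.∣-∣-nonNeg q}} p≤C ⟩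
    C ℚ.* ℚ.∣ q ∣        <⟨ ℚₚ.*-monoʳ-<-pos C {{ℚ.positive 0<C}} q<δ ⟩
    C ℚ.* δ              ∎
    where open ℚₚ.≤-Reasoning

  ∣ab-cd∣<ε : ∀ a b c d {A B δ} → 0ℚ ℚ.< A → 0ℚ ℚ.< B →
    ℚ.∣ a ∣ ℚ.≤ A ℚ.+ B → ℚ.∣ d ∣ ℚ.≤ A ℚ.+ B →
    ℚ.∣ b ℚ.- d ∣ ℚ.< δ → ℚ.∣ a ℚ.- c ∣ ℚ.< δ →
    ℚ.∣ a ℚ.* b ℚ.- c ℚ.* d ∣ ℚ.< (A ℚ.+ B) ℚ.* δ ℚ.+ (A ℚ.+ B) ℚ.* δ
  ∣ab-cd∣<ε a b c d {A} {B} {δ} 0<A 0<B a≤ d≤ b-d a-c = begin-strict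
    ℚ.∣ a ℚ.* b ℚ.- c ℚ.* d ∣
      ≡⟨ cong ℚ.∣_∣ (split a b c d) ⟩
    ℚ.∣ a ℚ.* (b ℚ.- d) ℚ.+ d ℚ.* (a ℚ.- c) ∣
      ≤⟨ ℚₚ.∣p+q∣≤∣p∣+∣q∣ (a ℚ.* (b ℚ.- d)) (d ℚ.* (a ℚ.- c)) ⟩
    ℚ.∣ a ℚ.* (b ℚ.- d) ∣ ℚ.+ ℚ.∣ d ℚ.* (a ℚ.- c) ∣
      <⟨ ℚₚ.+-mono-< (∣p*q∣<C*δ a (b ℚ.- d) (ℚₚ.+-mono-< 0<A 0<B) a≤ b-d)
                     (∣p*q∣<C*δ d (a ℚ.- c) (ℚₚ.+-mono-< 0<A 0<B) d≤ a-c) ⟩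
    (A ℚ.+ B) ℚ.* δ ℚ.+ (A ℚ.+ B) ℚ.* δ ∎
    where
    open ℚₚ.≤-Reasoning
    open +-*-Solver
    split : ∀ a b c d → a ℚ.* b ℚ.- c ℚ.* d ≡ a ℚ.* (b ℚ.- d) ℚ.+ d ℚ.* (a ℚ.- c)
    split = solve 4 (λ a b c d → a :* b :- c :* d := a :* (b :- d) :+ d :* (a :- c)) refl

  p≤p+q : ∀ p q → 0ℚ ℚ.< q → p ℚ.≤ p ℚ.+ q
  p≤p+q p q 0<q = subst (ℚ._≤ p ℚ.+ q) (ℚₚ.+-identityʳ p) (ℚₚ.+-monoʳ-≤ p (ℚₚ.<⇒≤ 0<q))

  q≤p+q : ∀ p q → 0ℚ ℚ.< p → q ℚ.≤ p ℚ.+ q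
  q≤p+q p q 0<p = subst (q ℚ.≤_) (ℚₚ.+-comm q p) (p≤p+q q p 0<p)

  *-cauchy : ∀ {x y} → Cauchy x → Cauchy y → Cauchy (λ n → x n ℚ.* y n)
  *-cauchy {x} {y} cx cy ε 0<ε = go (bounded cx) (bounded cy)
    where
    Bound : (ℕ → ℚ) → Set
    Bound z = ∃[ B ] 0ℚ ℚ.< B × ∃[ N ] (∀ n → N ℕ.≤ n → ℚ.∣ z n ∣ ℚ.≤ B)
    Close : (ℕ → ℚ) → ℚ → Set
    Close z δ = ∃[ N ] (∀ m n → N ℕ.≤ m → N ℕ.≤ n → ℚ.∣ z m ℚ.- z n ∣ ℚ.< δ)

    finish : ∀ {A B} δ → 0ℚ ℚ.< A → 0ℚ ℚ.< B → (A ℚ.+ B) ℚ.* δ ℚ.+ (A ℚ.+ B) ℚ.* δ ≡ ε →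
      ∃[ K ] (∀ n → K ℕ.≤ n → ℚ.∣ x n ∣ ℚ.≤ A) →
      ∃[ L ] (∀ n → L ℕ.≤ n → ℚ.∣ y n ∣ ℚ.≤ B) →
      Close x δ → Close y δ → Close (λ n → x n ℚ.* y n) ε
    finish {A} {B} δ 0<A 0<B eq (K , hK) (L , hL) (M , hM) (N , hN) = (K ⊔ L) ⊔ (M ⊔ N) , λ m n m≥ n≥ →
      subst (ℚ.∣ x m ℚ.* y m ℚ.- x n ℚ.* y n ∣ ℚ.<_) eq
        (∣ab-cd∣<ε (x m) (y m) (x n) (y n) {A} {B} {δ} 0<A 0<B
          (ℚₚ.≤-trans (hK m (≥K m≥)) (p≤p+q A B 0<B))
          (ℚₚ.≤-trans (hL n (≥L n≥)) (q≤p+q A B 0<A))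
          (hN m n (≥N m≥) (≥N n≥))
          (hM m n (≥M m≥) (≥M n≥)))
      where
      ≥K : ∀ {k} → (K ⊔ L) ⊔ (M ⊔ N) ℕ.≤ k → K ℕ.≤ k
      ≥K p = ℕₚ.m⊔n≤o⇒m≤o K L (ℕₚ.m⊔n≤o⇒m≤o (K ⊔ L) (M ⊔ N) p)
      ≥L : ∀ {k} → (K ⊔ L) ⊔ (M ⊔ N) ℕ.≤ k → L ℕ.≤ k
      ≥L p = ℕₚ.m⊔n≤o⇒n≤o K L (ℕₚ.m⊔n≤o⇒m≤o (K ⊔ L) (M ⊔ N) p)
      ≥M : ∀ {k} → (K ⊔ L) ⊔ (M ⊔ N) ℕ.≤ k → M ℕ.≤ k
      ≥M p = ℕₚ.m⊔n≤o⇒m≤o M N (ℕₚ.m⊔n≤o⇒n≤o (K ⊔ L) (M ⊔ N) p)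
      ≥N : ∀ {k} → (K ⊔ L) ⊔ (M ⊔ N) ℕ.≤ k → N ℕ.≤ k
      ≥N p = ℕₚ.m⊔n≤o⇒n≤o M N (ℕₚ.m⊔n≤o⇒n≤o (K ⊔ L) (M ⊔ N) p)

    go : Bound x → Bound y → Close (λ n → x n ℚ.* y n) ε
    go (A , 0<A , hA) (B , 0<B , hB) =
      let δ , 0<δ , eq = shrink (A ℚ.+ B) ε (ℚₚ.+-mono-< {0ℚ} {A} {0ℚ} {B} 0<A 0<B) 0<ε
      in  finish {A} {B} δ 0<A 0<B eq hA hB (cx δ 0<δ) (cy δ 0<δ)

-- The real numbers are Cauchy sequences of rationals up to _≈_.
record ℝ : Set where
  constructor mkℝ
  field
    seq    : ℕ → ℚ
    cauchy : Cauchy seq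

open ℝ public

infix  4 _≈_ _<_ _≤_
infixl 6 _+_ _-_
infixl 7 _*_
infix  8 -_

record _≈_ (x y : ℝ) : Set where
  constructor mk≈
  field
    close : ∀ ε → 0ℚ ℚ.< ε →
            ∃[ N ] (∀ n → N ℕ.≤ n → ℚ.∣ seq x n ℚ.- seq y n ∣ ℚ.< ε)

record _<_ (x y : ℝ) : Set where
  constructor mk<
  field
    gap       : ℚ
    0<gap     : 0ℚ ℚ.< gap
    separated : ∃[ N ] (∀ n → N ℕ.≤ n → seq x n ℚ.+ gap ℚ.≤ seq y n)

_≤_ : ℝ → ℝ → Set
x ≤ y = ¬ (y < x)

fromℚ : ℚ → ℝ
fromℚ q = mkℝ (λ _ → q) (const-cauchy q)

0ℝ 1ℝ : ℝ
0ℝ = fromℚ 0ℚ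
1ℝ = fromℚ 1ℚ

-_ ∣_∣ : ℝ → ℝ
- x   = mkℝ (λ n → ℚ.- seq x n) (neg-cauchy {seq x} (cauchy x))
∣ x ∣ = mkℝ (λ n → ℚ.∣ seq x n ∣) (abs-cauchy {seq x} (cauchy x))

_+_ _*_ : ℝ → ℝ → ℝ
x + y = mkℝ (λ n → seq x n ℚ.+ seq y n) (+-cauchy {seq x} {seq y} (cauchy x) (cauchy y))
x * y = mkℝ (λ n → seq x n ℚ.* seq y n) (*-cauchy {seq x} {seq y} (cauchy x) (cauchy y))

_-_ : ℝ → ℝ → ℝ
x - y = x + (- y)

record ℝ² : Set where
  constructor ⟨_,_⟩
  field
    xco yco : ℝ

open ℝ² public

infix  4 _≈²_ _≉²_
infixl 6 _+²_ _-²_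
infixl 7 _·_

_≈²_ _≉²_ : ℝ² → ℝ² → Set
p ≈² q = (xco p ≈ xco q) × (yco p ≈ yco q)
p ≉² q = ¬ (p ≈² q)

_+²_ _-²_ : ℝ² → ℝ² → ℝ²
p +² q = ⟨ xco p + xco q , yco p + yco q ⟩
p -² q = ⟨ xco p - xco q , yco p - yco q ⟩

_·_ : ℝ → ℝ² → ℝ²
s · p = ⟨ s * xco p , s * yco p ⟩

_∈[_,_] : ℝ² → ℝ² → ℝ² → Set
p ∈[ a , b ] = ∃[ s ] 0ℝ ≤ s × s ≤ 1ℝ × p ≈² a +² s · (b -² a)

-- Continuity on a subset D of ℝ, each point of D being paired with a proof of
-- membership.  Distance in the plane is the maximum of the coordinate distances.
Continuous : (D : ℝ → Set) → (∃ D → ℝ²) → Set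
Continuous D f = ∀ t ε → 0ℝ < ε → ∃[ δ ] 0ℝ < δ ×
  (∀ t′ → ∣ proj₁ t′ - proj₁ t ∣ < δ →
    ∣ xco (f t′) - xco (f t) ∣ < ε × ∣ yco (f t′) - yco (f t) ∣ < ε)

Label : Set
Label = [ n ∈ ℕ ∣ 0 ℕ.< n ]

-- 𝒜 ℓ m is the vector f^ℓ_{m+1}: this and all other sequences are indexed from 0.
Algorithm : Set
Algorithm = Label → ℕ → ℝ²

-- A route is given by its vertices a₀, a₁, …; its m-th segment is [a_m, a_{m+1}].
Route : Set
Route = ℕ → ℝ²

route : Algorithm → Label → ℝ² → Route
route 𝒜 ℓ v zero    = v
route 𝒜 ℓ v (suc m) = route 𝒜 ℓ v m +² 𝒜 ℓ m

ℝ≥0 : Set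
ℝ≥0 = ∃[ t ] 0ℝ ≤ t

Between : ℝ → ℝ → ℝ → Set
Between a b t = a ≤ t × t ≤ b

-- A function on a subset of ℝ must respect _≈_.  For the pieces this follows
-- from continuity; for the whole walk it is required explicitly.
record IsWalk (a : Route) (f : ℝ≥0 → ℝ²) : Set where
  field
    cong-f     : ∀ s t → proj₁ s ≈ proj₁ t → f s ≈² f t
    time       : ℕ → ℝ
    starts     : time 0 ≈ 0ℝ
    increasing : ∀ m → time m < time (suc m)
    unbounded  : ∀ B → ∃[ M ] (∀ m → M ℕ.≤ m → B < time m)
    piece      : ∀ m → ∃ (Between (time m) (time (suc m))) → ℝ²
    continuous : ∀ m → Continuous (Between (time m) (time (suc m))) (piece m)
    inSegment  : ∀ m t → piece m t ∈[ a m , a (suc m) ]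
    atStart    : ∀ m t → proj₁ t ≈ time m → piece m t ≈² a m
    atEnd      : ∀ m t → proj₁ t ≈ time (suc m) → piece m t ≈² a (suc m)
    glue       : ∀ m t (0≤t : 0ℝ ≤ t) (t∈ : Between (time m) (time (suc m)) t) →
                 f (t , 0≤t) ≈² piece m (t , t∈)

module Submission where

-- Fix two labels and let the agents move in turns: during [2m, 2m+1] the second
-- agent traverses its m-th segment while the first rests at its m-th vertex, and
-- during [2m+1, 2m+2] the first traverses its m-th segment while the second rests
-- at its next vertex.  They can meet only if a vertex of one route lies on a
-- segment of the other.  If the first starts at 0 and the second at d, each such
-- incidence confines d to one of countably many segments, and d is constructed
-- off all of them by nested boxes of radius 4⁻ᵏ, the k-th segment being avoided
-- at step k.

module Rational where

  open import Defs using (shrink; ∣p-q∣≡∣q-p∣)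
  open import Data.Empty using (⊥)
  open import Data.Integer as ℤ using (+_)
  import Data.Integer.Properties as ℤₚ
  open import Data.Nat as ℕ using (ℕ; zero; suc)
  import Data.Nat.Properties as ℕₚ
  import Data.Nat.Coprimality as Coprimality
  open import Data.Product using (∃-syntax; _×_; _,_)
  open import Data.Rational
  open import Data.Rational.Properties
  open import Data.Rational.Solver using (module +-*-Solver)
  import Data.Rational.Unnormalised as ℚᵘ
  import Data.Rational.Unnormalised.Properties as ℚᵘₚ
  open import Data.Sum using (inj₁; inj₂)
  open import Relation.Nullary using (¬_; yes; no)
  open import Relation.Binary.PropositionalEquality
    using (_≡_; refl; sym; trans; cong; cong₂; subst; subst₂)
  open +-*-Solver

  -- Inequalities and absolute values of rationals.

  infixl 5 _⊕_

  _⊕_ : ∀ {p q r s} → p ≤ q → r ≤ s → p + r ≤ q + s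
  _⊕_ = +-mono-≤

  -- A linear consequence of p ≤ q: the premise e is r − s = p − q without subtraction.
  by : ∀ {p q r s} → p ≤ q → r + q ≡ s + p → r ≤ s
  by {p} {q} {r} {s} p≤q e = begin
    r            ≡⟨ solve 2 (λ r p → r := r :+ p :- p) refl r p ⟩
    r + p - p    ≤⟨ +-monoˡ-≤ (- p) (+-monoʳ-≤ r p≤q) ⟩
    r + q - p    ≡⟨ cong (_- p) e ⟩
    s + p - p    ≡⟨ solve 2 (λ s p → s :+ p :- p := s) refl s p ⟩
    s            ∎
    where open ≤-Reasoning

  by< : ∀ {p q r s} → p < q → r + q ≡ s + p → r < s
  by< {p} {q} {r} {s} p<q e = begin-strict
    r            ≡⟨ solve 2 (λ r p → r := r :+ p :- p) refl r p ⟩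
    r + p - p    <⟨ +-monoˡ-< (- p) (+-monoʳ-< r p<q) ⟩
    r + q - p    ≡⟨ cong (_- p) e ⟩
    s + p - p    ≡⟨ solve 2 (λ s p → s :+ p :- p := s) refl s p ⟩
    s            ∎
    where open ≤-Reasoning

  <⇒≱ : ∀ {p q} → p < q → ¬ (q ≤ p)
  <⇒≱ p<q q≤p = <-irrefl refl (<-≤-trans p<q q≤p)

  scale : ∀ {c p q} → 0ℚ ≤ c → p ≤ q → c * p ≤ c * q
  scale {c} 0≤c = *-monoˡ-≤-nonNeg c {{nonNegative 0≤c}}

  0≤* : ∀ {p q} → 0ℚ ≤ p → 0ℚ ≤ q → 0ℚ ≤ p * q
  0≤* {p} {q} 0≤p 0≤q = subst (_≤ p * q) (*-zeroʳ p) (scale 0≤p 0≤q)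

  0<* : ∀ {p q} → 0ℚ < p → 0ℚ < q → 0ℚ < p * q
  0<* {p} {q} 0<p 0<q = subst (_< p * q) (*-zeroʳ p) (*-monoʳ-<-pos p {{positive 0<p}} 0<q)

  ∣p∣≤ : ∀ {p q} → p ≤ q → - p ≤ q → ∣ p ∣ ≤ q
  ∣p∣≤ {p} {q} p≤q -p≤q with ∣p∣≡p∨∣p∣≡-p p
  ... | inj₁ e = subst (_≤ q) (sym e) p≤q
  ... | inj₂ e = subst (_≤ q) (sym e) -p≤q

  p≤∣p∣ : ∀ p → p ≤ ∣ p ∣
  p≤∣p∣ p with ≤-total 0ℚ p
  ... | inj₁ 0≤p = ≤-reflexive (sym (0≤p⇒∣p∣≡p 0≤p))
  ... | inj₂ p≤0 = ≤-trans p≤0 (0≤∣p∣ p)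

  -p≤∣p∣ : ∀ p → - p ≤ ∣ p ∣
  -p≤∣p∣ p = subst (- p ≤_) (∣-p∣≡∣p∣ p) (p≤∣p∣ (- p))

  -∣p∣≤p : ∀ p → - ∣ p ∣ ≤ p
  -∣p∣≤p p = by (-p≤∣p∣ p) (solve 2 (λ a p → :- a :+ a := p :+ :- p) refl ∣ p ∣ p)

  ∣p*q∣≤ : ∀ p q {a b} → ∣ p ∣ ≤ a → ∣ q ∣ ≤ b → ∣ p * q ∣ ≤ a * b
  ∣p*q∣≤ p q {a} {b} p≤a q≤b = begin
    ∣ p * q ∣      ≡⟨ ∣p*q∣≡∣p∣*∣q∣ p q ⟩
    ∣ p ∣ * ∣ q ∣  ≤⟨ *-monoʳ-≤-nonNeg ∣ q ∣ {{∣-∣-nonNeg q}} p≤a ⟩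
    a * ∣ q ∣      ≤⟨ scale (≤-trans (0≤∣p∣ p) p≤a) q≤b ⟩
    a * b          ∎
    where open ≤-Reasoning

  p≤q+∣p-q∣ : ∀ p q → p ≤ q + ∣ p - q ∣
  p≤q+∣p-q∣ p q = by (p≤∣p∣ (p - q))
    (solve 3 (λ p q a → p :+ a := q :+ a :+ (p :- q)) refl p q ∣ p - q ∣)

  triangle : ∀ p q r → ∣ p - r ∣ ≤ ∣ p - q ∣ + ∣ q - r ∣
  triangle p q r = subst (λ z → ∣ z ∣ ≤ ∣ p - q ∣ + ∣ q - r ∣)
    (solve 3 (λ p q r → (p :- q) :+ (q :- r) := p :- r) refl p q r)
    (∣p+q∣≤∣p∣+∣q∣ (p - q) (q - r))

  half-< : ∀ {p} → 0ℚ < p → ½ * p < p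
  half-< {p} 0<p = by< (0<* {½} (positive⁻¹ ½) 0<p)
    (solve 1 (λ p → con ½ :* p :+ con ½ :* p := p :+ con 0ℚ) refl p)

  sign : ℚ → ℚ
  sign p with ≤-total 0ℚ p
  ... | inj₁ _ = 1ℚ
  ... | inj₂ _ = - 1ℚ

  p*sign[p]≡∣p∣ : ∀ p → p * sign p ≡ ∣ p ∣
  p*sign[p]≡∣p∣ p with ≤-total 0ℚ p
  ... | inj₁ 0≤p = trans (*-identityʳ p) (sym (0≤p⇒∣p∣≡p 0≤p))
  ... | inj₂ p≤0 = trans (solve 1 (λ p → p :* :- con 1ℚ := :- p) refl p)
    (trans (sym (0≤p⇒∣p∣≡p (neg-antimono-≤ p≤0))) (∣-p∣≡∣p∣ p))

  ∣sign∣≤1 : ∀ p → ∣ sign p ∣ ≤ 1ℚ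
  ∣sign∣≤1 p with ≤-total 0ℚ p
  ... | inj₁ _ = ≤-refl
  ... | inj₂ _ = ≤-refl

  -- Clamping to the unit interval.

  clamp : ℚ → ℚ
  clamp p = 0ℚ ⊔ (p ⊓ 1ℚ)

  0≤clamp : ∀ p → 0ℚ ≤ clamp p
  0≤clamp p = p≤p⊔q 0ℚ (p ⊓ 1ℚ)

  clamp≤1 : ∀ p → clamp p ≤ 1ℚ
  clamp≤1 p = ⊔-lub (nonNegative⁻¹ 1ℚ) (p⊓q≤q p 1ℚ)

  clamp-≤ : ∀ {p q} → 0ℚ ≤ q → p ≤ q → clamp p ≤ q
  clamp-≤ {p} 0≤q p≤q = ⊔-lub 0≤q (≤-trans (p⊓q≤p p 1ℚ) p≤q)

  clamp-≥ : ∀ {p q} → q ≤ 1ℚ → q ≤ p → q ≤ clamp p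
  clamp-≥ {p} q≤1 q≤p = ≤-trans (⊓-glb q≤p q≤1) (p≤q⊔p 0ℚ (p ⊓ 1ℚ))

  -- If `q ≤ 1`, then `q ≤ clamp q`, and the right side dominates both 0 and `p`. If `1 ≤ q`, then
  -- `clamp q` is already at the top value 1.
  clamp-p≤clamp-q+∣p-q∣ : ∀ p q → clamp p ≤ clamp q + ∣ p - q ∣
  clamp-p≤clamp-q+∣p-q∣ p q with ≤-total q 1ℚ
  ... | inj₁ q≤1 = clamp-≤
    (0≤clamp q ⊕ 0≤∣p∣ (p - q))
    (≤-trans (p≤q+∣p-q∣ p q) (+-monoˡ-≤ ∣ p - q ∣ (clamp-≥ q≤1 ≤-refl)))
  ... | inj₂ 1≤q = ≤-trans (clamp≤1 p)
    (by (clamp-≥ ≤-refl 1≤q ⊕ 0≤∣p∣ (p - q))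
      (solve 2 (λ a c → con 1ℚ :+ (c :+ a) := (c :+ a) :+ (con 1ℚ :+ con 0ℚ)) refl ∣ p - q ∣ (clamp q)))

  clamp-nonexpansive : ∀ p q → ∣ clamp p - clamp q ∣ ≤ ∣ p - q ∣
  clamp-nonexpansive p q = ∣p∣≤
    (by (clamp-p≤clamp-q+∣p-q∣ p q)
      (solve 3 (λ p q a → (p :- q) :+ (q :+ a) := a :+ p) refl (clamp p) (clamp q) ∣ p - q ∣))
    (by (subst (λ a → clamp q ≤ clamp p + a) (∣p-q∣≡∣q-p∣ q p) (clamp-p≤clamp-q+∣p-q∣ q p))
      (solve 3 (λ p q a → :- (p :- q) :+ (p :+ a) := a :+ q) refl (clamp p) (clamp q) ∣ p - q ∣))

  -- The Archimedean property and the slot boundaries.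

  fromℕ : ℕ → ℚ
  fromℕ m = mkℚ (+ m) 0 (Coprimality.sym (Coprimality.1-coprimeTo m))

  -- Normalised addition involves a gcd that does not reduce for a variable `m`, so the equation is
  -- checked on unnormalised rationals.
  fromℕ-suc : ∀ m → fromℕ (suc m) ≡ fromℕ m + 1ℚ
  fromℕ-suc m = toℚᵘ-injective (ℚᵘₚ.≃-trans
    (ℚᵘ.*≡* (cong (ℤ._* + 1) {+ suc m} (trans (cong +_ (ℕₚ.+-comm 1 m)) (sym (cong (ℤ._+ + 1) (ℤₚ.*-identityʳ (+ m)))))))
    (ℚᵘₚ.≃-sym (toℚᵘ-homo-+ (fromℕ m) 1ℚ)))

  -- The denominator is at least 1, so dropping it from a nonnegative fraction only increases the
  -- value.
  p≤fromℕ∣↥p∣ : ∀ p → p ≤ fromℕ ℤ.∣ ↥ p ∣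
  p≤fromℕ∣↥p∣ p@record{} = *≤* (subst (ℤ._≤ + ℤ.∣ ↥ p ∣ ℤ.* ↧ p) (sym (ℤₚ.*-identityʳ (↥ p)))
    (ℤₚ.≤-trans (n≤∣n∣ (↥ p)) (subst (+ ℤ.∣ ↥ p ∣ ℤ.≤_) (ℤₚ.pos-* ℤ.∣ ↥ p ∣ (↧ₙ p))
      (ℤ.+≤+ (ℕₚ.m≤m*n ℤ.∣ ↥ p ∣ (↧ₙ p))))))
    where
    n≤∣n∣ : ∀ n → n ℤ.≤ + ℤ.∣ n ∣
    n≤∣n∣ (+ n) = ℤₚ.≤-refl
    n≤∣n∣ (ℤ.-[1+ n ]) = ℤ.-≤+

  -- The slot boundary 2m. With this recursion, adding 1 twice to a boundary gives the next one by
  -- computation.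
  double : ℕ → ℚ
  double zero    = 0ℚ
  double (suc m) = double m + 1ℚ + 1ℚ

  fromℕ≤double : ∀ m → fromℕ m ≤ double m
  fromℕ≤double zero    = ≤-refl
  fromℕ≤double (suc m) = subst (_≤ double (suc m)) (sym (fromℕ-suc m))
    (by (fromℕ≤double m ⊕ nonNegative⁻¹ 1ℚ)
      (solve 2 (λ a d → (a :+ con 1ℚ) :+ (d :+ con 1ℚ) := (d :+ con 1ℚ :+ con 1ℚ) :+ (a :+ con 0ℚ)) refl (fromℕ m) (double m)))

  archimedean : ∀ p → ∃[ m ] p ≤ double m
  archimedean p = ℤ.∣ ↥ p ∣ , ≤-trans (p≤fromℕ∣↥p∣ p) (fromℕ≤double ℤ.∣ ↥ p ∣)

  double-≤-suc : ∀ m → double m ≤ double (suc m)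
  double-≤-suc m = by (nonNegative⁻¹ 1ℚ ⊕ nonNegative⁻¹ 1ℚ)
    (solve 1 (λ d → d :+ (con 1ℚ :+ con 1ℚ) := (d :+ con 1ℚ :+ con 1ℚ) :+ (con 0ℚ :+ con 0ℚ)) refl (double m))

  0≤double : ∀ m → 0ℚ ≤ double m
  0≤double zero    = ≤-refl
  0≤double (suc m) = ≤-trans (0≤double m) (double-≤-suc m)

  -- Moving a box off a line.

  normal-vector : ∀ a b → ∃[ α ] ∃[ β ] 0ℚ < ∣ α ∣ + ∣ β ∣ × α * a + β * b ≡ 0ℚ
  normal-vector a b with a ≟ 0ℚ
  -- The zero direction of a degenerate segment falls under this case, so a nonzero normal always
  -- exists. Equality with 0 is decidable because the data are rational.
  ... | yes a≡0 = 1ℚ , 0ℚ , positive⁻¹ (1ℚ + 0ℚ)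
      , trans (solve 2 (λ a b → con 1ℚ :* a :+ con 0ℚ :* b := a) refl a b) a≡0
  ... | no a≢0 = - b , a , +-mono-≤-< (0≤∣p∣ (- b)) (≰⇒> λ ∣a∣≤0 → a≢0 (∣p∣≡0⇒p≡0 a (≤-antisym ∣a∣≤0 (0≤∣p∣ a))))
      , solve 2 (λ a b → :- b :* a :+ a :* b := con 0ℚ) refl a b

  ¼ ¹/₃₂ : ℚ
  ¼ = ½ * ½
  ¹/₃₂ = + 1 / 32

  -- Shifting the centre along the signs of `α` and `β` raises the functional by ½r(|α| + |β|).
  -- Within the new box of radius ¼r at most half of this gain is lost.
  push-up : ∀ α β l cx cy r → l ≤ α * cx + β * cy →
    ∀ x y → ∣ x - (cx + ½ * r * sign α) ∣ ≤ ¼ * r → ∣ y - (cy + ½ * r * sign β) ∣ ≤ ¼ * r →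
    ¼ * r * (∣ α ∣ + ∣ β ∣) ≤ α * x + β * y - l
  push-up α β l cx cy r l≤ x y x≈ y≈ =
    by (l≤ ⊕ lower α (x - (cx + ½ * r * sign α)) x≈ ⊕ lower β (y - (cy + ½ * r * sign β)) y≈) (trans
      (cong₂ (λ a b → ¼ * r * (a + b) + (α * cx + β * cy + α * (x - (cx + ½ * r * sign α)) + β * (y - (cy + ½ * r * sign β))))
        (sym (p*sign[p]≡∣p∣ α)) (sym (p*sign[p]≡∣p∣ β)))
      (trans
        (solve 10 (λ α β l cx cy r x y s t →
            con ¼ :* r :* (α :* s :+ β :* t) :+ (α :* cx :+ β :* cy :+ α :* (x :- (cx :+ con ½ :* r :* s)) :+ β :* (y :- (cy :+ con ½ :* r :* t)))
            := α :* x :+ β :* y :- l :+ (l :+ :- (α :* s :* (con ¼ :* r)) :+ :- (β :* t :* (con ¼ :* r))))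
          refl α β l cx cy r x y (sign α) (sign β))
        (cong₂ (λ a b → α * x + β * y - l + (l + - (a * (¼ * r)) + - (b * (¼ * r))))
          (p*sign[p]≡∣p∣ α) (p*sign[p]≡∣p∣ β))))
    where
    lower : ∀ p q {b} → ∣ q ∣ ≤ b → - (∣ p ∣ * b) ≤ p * q
    lower p q ∣q∣≤b = ≤-trans (neg-antimono-≤ (∣p*q∣≤ p q ≤-refl ∣q∣≤b)) (-∣p∣≤p (p * q))

  ∣shift∣≤ : ∀ {r} → 0ℚ < r → ∀ c γ → ∣ c + ½ * r * sign γ - c ∣ ≤ ½ * r
  ∣shift∣≤ {r} 0<r c γ = subst₂ _≤_
    (cong ∣_∣ (solve 2 (λ c h → h := c :+ h :- c) refl c (½ * r * sign γ)))
    (*-identityʳ (½ * r))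
    (∣p*q∣≤ (½ * r) (sign γ) (≤-reflexive (0≤p⇒∣p∣≡p (<⇒≤ (0<* (positive⁻¹ ½) 0<r)))) (∣sign∣≤1 γ))

  push : ∀ α β l cx cy r → 0ℚ < r → ∃[ cx′ ] ∃[ cy′ ]
    ∣ cx′ - cx ∣ ≤ ½ * r × ∣ cy′ - cy ∣ ≤ ½ * r ×
    (∀ x y → ∣ x - cx′ ∣ ≤ ¼ * r → ∣ y - cy′ ∣ ≤ ¼ * r →
      ¼ * r * (∣ α ∣ + ∣ β ∣) ≤ ∣ α * x + β * y - l ∣)
  push α β l cx cy r 0<r with ≤-total l (α * cx + β * cy)
  ... | inj₁ l≤ = cx + ½ * r * sign α , cy + ½ * r * sign β , ∣shift∣≤ 0<r cx α , ∣shift∣≤ 0<r cy β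
      , λ x y x≈ y≈ → ≤-trans (push-up α β l cx cy r l≤ x y x≈ y≈) (p≤∣p∣ _)
  -- A centre on the other side of the line is pushed down, which is `push-up` for the negated
  -- functional.
  ... | inj₂ ≤l = cx + ½ * r * sign (- α) , cy + ½ * r * sign (- β) , ∣shift∣≤ 0<r cx (- α) , ∣shift∣≤ 0<r cy (- β)
      , λ x y x≈ y≈ → ≤-trans
          (subst₂ _≤_ (cong₂ (λ a b → ¼ * r * (a + b)) (∣-p∣≡∣p∣ α) (∣-p∣≡∣p∣ β))
            (solve 5 (λ α β l x y → :- α :* x :+ :- β :* y :- :- l := :- (α :* x :+ β :* y :- l)) refl α β l x y)
            (push-up (- α) (- β) (- l) cx cy r
              (subst (- l ≤_) (solve 4 (λ α β x y → :- (α :* x :+ β :* y) := :- α :* x :+ :- β :* y) refl α β cx cy)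
                (neg-antimono-≤ ≤l)) x y x≈ y≈))
          (-p≤∣p∣ _)

  -- The four errors are one for `x`, one for the base point and two for the direction, since `s` is
  -- bounded by 2. The bound is 2 rather than 1 because the terms of a real in [0, 1] may slightly
  -- exceed 1.
  near-line : ∀ x p s u p′ u′ {η} → ∣ x - (p + s * u) ∣ ≤ η → ∣ p - p′ ∣ ≤ η → ∣ s ∣ ≤ 1ℚ + 1ℚ → ∣ u - u′ ∣ ≤ η →
    ∣ x - (p′ + s * u′) ∣ ≤ η + η + η + η
  near-line x p s u p′ u′ {η} x≈ p≈ s≤2 u≈ = begin
    ∣ x - (p′ + s * u′) ∣
      ≤⟨ triangle x (p + s * u) (p′ + s * u′) ⟩
    ∣ x - (p + s * u) ∣ + ∣ p + s * u - (p′ + s * u′) ∣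
      ≤⟨ x≈ ⊕ subst (λ z → ∣ z ∣ ≤ η + (1ℚ + 1ℚ) * η)
           (solve 5 (λ p s u p′ u′ → (p :- p′) :+ s :* (u :- u′) := p :+ s :* u :- (p′ :+ s :* u′)) refl p s u p′ u′)
           (≤-trans (∣p+q∣≤∣p∣+∣q∣ (p - p′) (s * (u - u′))) (p≈ ⊕ ∣p*q∣≤ s (u - u′) s≤2 u≈)) ⟩
    η + (η + (1ℚ + 1ℚ) * η)
      ≡⟨ solve 1 (λ η → η :+ (η :+ (con 1ℚ :+ con 1ℚ) :* η) := η :+ η :+ η :+ η) refl η ⟩
    η + η + η + η ∎
    where open ≤-Reasoning

  -- The functional αx + βy is constant along the segment; a shift of the box by
  -- (±½r, ±½r) with signs fitting α and β moves the functional away from that value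
  -- by more than the error made in replacing real data by rational approximations.
  dodge : ∀ px py ux uy cx cy r → 0ℚ < r → ∃[ cx′ ] ∃[ cy′ ]
    ∣ cx′ - cx ∣ ≤ ½ * r × ∣ cy′ - cy ∣ ≤ ½ * r ×
    (∀ x y s → ∣ x - cx′ ∣ ≤ ¼ * r → ∣ y - cy′ ∣ ≤ ¼ * r →
      ∣ x - (px + s * ux) ∣ ≤ ½ * (¼ * r) → ∣ y - (py + s * uy) ∣ ≤ ½ * (¼ * r) → ⊥)
  dodge px py ux uy cx cy r 0<r =
    let α , β , 0<αβ , αβ⊥u = normal-vector ux uy
        cx′ , cy′ , cx≈ , cy≈ , far = push α β (α * px + β * py) cx cy r 0<r
    in cx′ , cy′ , cx≈ , cy≈ , λ x y s x≈ y≈ x-line y-line →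
      <⇒≱ (0<* (0<* (positive⁻¹ ½) (0<* (positive⁻¹ ¼) 0<r)) 0<αβ)
        (too-close α β αβ⊥u x y s x-line y-line (far x y x≈ y≈))
    where
    -- A point within ⅛r of the line in each coordinate changes the functional by at most ⅛r(|α| +
    -- |β|), while `far` demands twice as much.
    too-close : ∀ α β → α * ux + β * uy ≡ 0ℚ → ∀ x y s →
      ∣ x - (px + s * ux) ∣ ≤ ½ * (¼ * r) → ∣ y - (py + s * uy) ∣ ≤ ½ * (¼ * r) →
      ¼ * r * (∣ α ∣ + ∣ β ∣) ≤ ∣ α * x + β * y - (α * px + β * py) ∣ →
      ½ * (¼ * r) * (∣ α ∣ + ∣ β ∣) ≤ 0ℚ
    too-close α β αβ⊥u x y s x-line y-line far = by (≤-trans far near)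
      (solve 3 (λ r a b → con ½ :* (con ¼ :* r) :* (a :+ b) :+ (a :* (con ½ :* (con ¼ :* r)) :+ b :* (con ½ :* (con ¼ :* r)))
         := con 0ℚ :+ con ¼ :* r :* (a :+ b)) refl r ∣ α ∣ ∣ β ∣)
      where
      ex = x - (px + s * ux)
      ey = y - (py + s * uy)
      open ≤-Reasoning
      near : ∣ α * x + β * y - (α * px + β * py) ∣ ≤ ∣ α ∣ * (½ * (¼ * r)) + ∣ β ∣ * (½ * (¼ * r))
      near = begin
        ∣ α * x + β * y - (α * px + β * py) ∣
          ≡⟨ cong ∣_∣ (solve 9 (λ α β x y px py ux uy s →
               α :* x :+ β :* y :- (α :* px :+ β :* py) :=
               α :* (x :- (px :+ s :* ux)) :+ β :* (y :- (py :+ s :* uy)) :+ s :* (α :* ux :+ β :* uy)) refl α β x y px py ux uy s) ⟩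
        ∣ α * ex + β * ey + s * (α * ux + β * uy) ∣
          ≡⟨ cong (λ z → ∣ α * ex + β * ey + s * z ∣) αβ⊥u ⟩
        ∣ α * ex + β * ey + s * 0ℚ ∣
          ≡⟨ cong ∣_∣ (solve 2 (λ z s → z :+ s :* con 0ℚ := z) refl (α * ex + β * ey) s) ⟩
        ∣ α * ex + β * ey ∣
          ≤⟨ ∣p+q∣≤∣p∣+∣q∣ (α * ex) (β * ey) ⟩
        ∣ α * ex ∣ + ∣ β * ey ∣
          ≤⟨ ∣p*q∣≤ α ex ≤-refl x-line ⊕ ∣p*q∣≤ β ey ≤-refl y-line ⟩
        ∣ α ∣ * (½ * (¼ * r)) + ∣ β ∣ * (½ * (¼ * r)) ∎

  -- Radii of the nested boxes.

  radius : ℕ → ℚ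
  radius zero    = 1ℚ
  radius (suc k) = ¼ * radius k

  0<radius : ∀ k → 0ℚ < radius k
  0<radius zero    = positive⁻¹ 1ℚ
  0<radius (suc k) = 0<* (positive⁻¹ ¼) (0<radius k)

  -- A linear rate is enough for convergence to 0. With d = 2k the inductive step is (3 + d)/4 ≤ 1 +
  -- d, with slack ¼ + ¾d.
  radius-decay : ∀ k → (1ℚ + double k) * radius k ≤ 1ℚ
  radius-decay zero    = ≤-refl
  radius-decay (suc k) = ≤-trans
    (by (0≤* (<⇒≤ (0<radius k)) (nonNegative⁻¹ ¼ ⊕ 0≤* (nonNegative⁻¹ (½ + ¼)) (0≤double k)))
      (solve 2 (λ d r → (con 1ℚ :+ (d :+ con 1ℚ :+ con 1ℚ)) :* (con ¼ :* r) :+ r :* (con ¼ :+ con (½ + ¼) :* d)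
                        := (con 1ℚ :+ d) :* r :+ con 0ℚ) refl (double k) (radius k)))
    (radius-decay k)

  radius-small : ∀ ε → 0ℚ < ε → ∃[ k ] radius k < ε
  radius-small ε 0<ε with shrink ε 1ℚ 0<ε (positive⁻¹ 1ℚ)
  ... | δ , 0<δ , 2εδ≡1 with archimedean (δ + δ)
  -- Here 2δ = 1/ε and 2k ≥ 1/ε. If ε were at most `radius k`, then ε + 1 = (1 + 1/ε)ε ≤ (1 + 2k) ·
  -- `radius k` ≤ 1.
  ... | k , 2δ≤ = k , ≰⇒> λ ε≤r → <⇒≱ 0<ε
    (by (≤-trans (≤-trans (scale (<⇒≤ 0<1+2δ) ε≤r)
            (*-monoʳ-≤-nonNeg (radius k) {{nonNegative (<⇒≤ (0<radius k))}} (+-monoʳ-≤ 1ℚ 2δ≤)))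
          (radius-decay k))
      (trans (sym (cong (λ z → ε + z) 2εδ≡1))
        (solve 2 (λ e d → e :+ (e :* d :+ e :* d) := con 0ℚ :+ (con 1ℚ :+ (d :+ d)) :* e) refl ε δ)))
    where
    0<1+2δ : 0ℚ < 1ℚ + (δ + δ)
    0<1+2δ = +-mono-< (positive⁻¹ 1ℚ) (+-mono-< 0<δ 0<δ)

  clamp-shift-nonexpansive : ∀ o p q → ∣ clamp (p - o) - clamp (q - o) ∣ ≤ ∣ p - q ∣
  clamp-shift-nonexpansive o p q = subst (λ z → ∣ clamp (p - o) - clamp (q - o) ∣ ≤ ∣ z ∣)
    (solve 3 (λ o p q → (p :- o) :- (q :- o) := p :- q) refl o p q)
    (clamp-nonexpansive (p - o) (q - o))

open Rational
open import Defs
open import Data.Empty using (⊥; ⊥-elim)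
open import Data.Nat as ℕ using (ℕ; zero; suc; _⊔_; _≤′_; ≤′-refl; ≤′-step)
import Data.Nat.Properties as ℕₚ
open import Data.Product using (∃; ∃-syntax; _×_; _,_; proj₁; proj₂)
open import Data.Rational as ℚ using (ℚ; 0ℚ; 1ℚ; ½)
import Data.Rational.Properties as ℚₚ
open import Data.Rational.Solver using (module +-*-Solver)
open import Data.Refinement using () renaming (_,_ to _,ᵣ_)
open import Data.Irrelevant using ([_])
open import Data.Sum using (inj₁; inj₂)
open import Relation.Nullary using (¬_; yes; no)
open import Relation.Binary.PropositionalEquality
  using (_≡_; _≢_; refl; sym; trans; cong; subst; subst₂)
open +-*-Solver

-- Order and equality of reals through eventual properties of their terms.

◇ : (ℕ → Set) → Set
◇ P = ∃[ N ] (∀ n → N ℕ.≤ n → P n)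

◇-now : ∀ {P} → ◇ P → ∃ P
◇-now (N , h) = N , h N ℕₚ.≤-refl

◇-always : ∀ {P : ℕ → Set} → (∀ n → P n) → ◇ P
◇-always h = 0 , λ n _ → h n

◇-map : ∀ {P Q : ℕ → Set} → (∀ n → P n → Q n) → ◇ P → ◇ Q
◇-map f (N , h) = N , λ n N≤n → f n (h n N≤n)

◇-zip : ∀ {P Q R : ℕ → Set} → (∀ n → P n → Q n → R n) → ◇ P → ◇ Q → ◇ R
◇-zip f (M , g) (N , h) = M ⊔ N , λ n M⊔N≤n →
  f n (g n (ℕₚ.m⊔n≤o⇒m≤o M N M⊔N≤n)) (h n (ℕₚ.m⊔n≤o⇒n≤o M N M⊔N≤n))

infixr 4 _∧_

_∧_ : ∀ {P Q : ℕ → Set} → ◇ P → ◇ Q → ◇ (λ n → P n × Q n)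
_∧_ = ◇-zip (λ _ p q → p , q)

approximation : ∀ x ε → 0ℚ ℚ.< ε → ∃[ q ] ◇ (λ n → ℚ.∣ seq x n ℚ.- q ∣ ℚ.≤ ε)
approximation x ε 0<ε with cauchy x ε 0<ε
... | N , h = seq x N , N , λ n N≤n → ℚₚ.<⇒≤ (h n N N≤n ℕₚ.≤-refl)

0<¼* : ∀ {ε} → 0ℚ ℚ.< ε → 0ℚ ℚ.< ¼ ℚ.* ε
0<¼* = 0<* (ℚₚ.positive⁻¹ ¼)

-- The negative statement `x ≤ y` yields positive information because a rational `q` within ¼ε of x
-- - y can be compared with ½ε. If `q` is larger, x exceeds y eventually by ¼ε, which is excluded;
-- otherwise x - y is eventually at most ¾ε.
≤⇒◇ : ∀ {x y} → x ≤ y → ∀ ε → 0ℚ ℚ.< ε → ◇ (λ n → seq x n ℚ.≤ seq y n ℚ.+ ε)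
≤⇒◇ {x} {y} x≤y ε 0<ε with approximation (x - y) (¼ ℚ.* ε) (0<¼* 0<ε)
... | q , near with q ℚₚ.≤? ½ ℚ.* ε
...   | yes q≤ = ◇-map (λ n h →
          by (p≤q+∣p-q∣ (seq x n ℚ.- seq y n) q ⊕ h ⊕ q≤ ⊕ ℚₚ.<⇒≤ (0<¼* 0<ε))
            (solve 5 (λ x y q a ε → x :+ (q :+ a :+ con ¼ :* ε :+ con ½ :* ε :+ con ¼ :* ε)
              := y :+ ε :+ (x :- y :+ a :+ q :+ con 0ℚ)) refl
              (seq x n) (seq y n) q ℚ.∣ seq x n ℚ.- seq y n ℚ.- q ∣ ε)) near
...   | no q≰ = ⊥-elim (x≤y (mk< (¼ ℚ.* ε) (0<¼* 0<ε) (◇-map (λ n h →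
          by (-p≤∣p∣ (seq x n ℚ.- seq y n ℚ.- q) ⊕ h ⊕ ℚₚ.<⇒≤ (ℚₚ.≰⇒> q≰))
            (solve 5 (λ x y q a ε → y :+ con ¼ :* ε :+ (a :+ con ¼ :* ε :+ q)
              := x :+ (:- (x :- y :- q) :+ a :+ con ½ :* ε)) refl
              (seq x n) (seq y n) q ℚ.∣ seq x n ℚ.- seq y n ℚ.- q ∣ ε)) near)))

◇⇒≤ : ∀ {x y} → (∀ ε → 0ℚ ℚ.< ε → ◇ (λ n → seq x n ℚ.≤ seq y n ℚ.+ ε)) → x ≤ y
◇⇒≤ {x} {y} h (mk< gap 0<gap sep) with ◇-now (h (½ ℚ.* gap) (half-pos 0<gap) ∧ sep)
... | n , x≤y+½gap , y+gap≤x = <⇒≱ (half-pos 0<gap)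
  (by (x≤y+½gap ⊕ y+gap≤x)
    (solve 3 (λ x y g → con ½ :* g :+ (y :+ con ½ :* g :+ x) := con 0ℚ :+ (x :+ (y :+ g))) refl (seq x n) (seq y n) gap))

always⇒≤ : ∀ {x y} → (∀ n → seq x n ℚ.≤ seq y n) → x ≤ y
always⇒≤ {x} {y} h = ◇⇒≤ {x} {y} λ ε 0<ε → ◇-always λ n →
  ℚₚ.≤-trans (h n) (p≤p+q (seq y n) ε 0<ε)

≤-trans : ∀ {x y z} → x ≤ y → y ≤ z → x ≤ z
≤-trans {x} {y} {z} x≤y y≤z = ◇⇒≤ {x} {z} λ ε 0<ε → ◇-zip
  (λ n h k → by (h ⊕ k)
    (solve 4 (λ x y z ε → x :+ (y :+ con ½ :* ε :+ (z :+ con ½ :* ε)) := z :+ ε :+ (x :+ y)) refl (seq x n) (seq y n) (seq z n) ε))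
  (≤⇒◇ {x} {y} x≤y (½ ℚ.* ε) (half-pos 0<ε))
  (≤⇒◇ {y} {z} y≤z (½ ℚ.* ε) (half-pos 0<ε))

-- The order of two reals cannot be decided, but a case split on it is sound when the goal is a
-- contradiction. Every claim that the agents do not meet is of this kind.
≤-total-¬¬ : ∀ x y → ¬ (x ≤ y) → ¬ (y ≤ x) → ⊥
≤-total-¬¬ x y x≰y y≰x = x≰y λ y<x → y≰x (◇⇒≤ {y} {x} λ ε 0<ε →
  ◇-map (λ n h → ℚₚ.≤-trans (ℚₚ.≤-trans (p≤p+q (seq y n) (_<_.gap y<x) (_<_.0<gap y<x)) h) (p≤p+q (seq x n) ε 0<ε))
    (_<_.separated y<x))

◇⇒≈ : ∀ {x y} → (∀ ε → 0ℚ ℚ.< ε → ◇ (λ n → ℚ.∣ seq x n ℚ.- seq y n ∣ ℚ.≤ ε)) → x ≈ y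
◇⇒≈ h = mk≈ λ ε 0<ε → ◇-map (λ n k → ℚₚ.≤-<-trans k (half-< 0<ε)) (h (½ ℚ.* ε) (half-pos 0<ε))

≈⇒◇ : ∀ {x y} → x ≈ y → ∀ ε → 0ℚ ℚ.< ε → ◇ (λ n → ℚ.∣ seq x n ℚ.- seq y n ∣ ℚ.≤ ε)
≈⇒◇ (mk≈ close) ε 0<ε = ◇-map (λ _ → ℚₚ.<⇒≤) (close ε 0<ε)

≗⇒≈ : ∀ {x y} → (∀ n → seq x n ≡ seq y n) → x ≈ y
≗⇒≈ {x} {y} h = ◇⇒≈ λ ε 0<ε → ◇-always λ n →
  subst (λ z → ℚ.∣ seq x n ℚ.- z ∣ ℚ.≤ ε) (h n)
    (subst (λ z → ℚ.∣ z ∣ ℚ.≤ ε) (sym (ℚₚ.+-inverseʳ (seq x n))) (ℚₚ.<⇒≤ 0<ε))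

≈-refl : ∀ {x} → x ≈ x
≈-refl = ≗⇒≈ λ _ → refl

≈-sym : ∀ {x y} → x ≈ y → y ≈ x
≈-sym {x} {y} x≈y = ◇⇒≈ λ ε 0<ε →
  ◇-map (λ n → subst (ℚ._≤ ε) (∣p-q∣≡∣q-p∣ (seq x n) (seq y n))) (≈⇒◇ x≈y ε 0<ε)

≈-trans : ∀ {x y z} → x ≈ y → y ≈ z → x ≈ z
≈-trans {x} {y} {z} x≈y y≈z = ◇⇒≈ λ ε 0<ε → ◇-zip
  (λ n h k → subst (ℚ.∣ seq x n ℚ.- seq z n ∣ ℚ.≤_) (half+half ε)
    (ℚₚ.≤-trans (triangle (seq x n) (seq y n) (seq z n)) (h ⊕ k)))
  (≈⇒◇ x≈y (½ ℚ.* ε) (half-pos 0<ε)) (≈⇒◇ y≈z (½ ℚ.* ε) (half-pos 0<ε))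

+-cong : ∀ {x y z w} → x ≈ y → z ≈ w → x + z ≈ y + w
+-cong {x} {y} {z} {w} x≈y z≈w = ◇⇒≈ λ ε 0<ε → ◇-zip
  (λ n h k → subst₂ ℚ._≤_
    (cong ℚ.∣_∣ (solve 4 (λ x y z w → (x :- y) :+ (z :- w) := x :+ z :- (y :+ w)) refl (seq x n) (seq y n) (seq z n) (seq w n)))
    (half+half ε)
    (ℚₚ.≤-trans (ℚₚ.∣p+q∣≤∣p∣+∣q∣ (seq x n ℚ.- seq y n) (seq z n ℚ.- seq w n)) (h ⊕ k)))
  (≈⇒◇ x≈y (½ ℚ.* ε) (half-pos 0<ε)) (≈⇒◇ z≈w (½ ℚ.* ε) (half-pos 0<ε))

*-congʳ : ∀ {x y} z → x ≈ y → x * z ≈ y * z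
*-congʳ {x} {y} z x≈y = ◇⇒≈ λ ε 0<ε → go ε 0<ε (bounded (cauchy z))
  where
  go : ∀ ε → 0ℚ ℚ.< ε → ∃[ B ] 0ℚ ℚ.< B × ◇ (λ n → ℚ.∣ seq z n ∣ ℚ.≤ B) →
    ◇ (λ n → ℚ.∣ seq x n ℚ.* seq z n ℚ.- seq y n ℚ.* seq z n ∣ ℚ.≤ ε)
  go ε 0<ε (B , 0<B , z≤B) with shrink B ε 0<B 0<ε
  ... | δ , 0<δ , 2Bδ≡ε = ◇-zip
    (λ n h k → subst (λ u → ℚ.∣ u ∣ ℚ.≤ ε)
      (solve 3 (λ x y z → z :* (x :- y) := x :* z :- y :* z) refl (seq x n) (seq y n) (seq z n))
      (ℚₚ.≤-trans (∣p*q∣≤ (seq z n) (seq x n ℚ.- seq y n) h k)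
        (subst (B ℚ.* δ ℚ.≤_) 2Bδ≡ε (p≤p+q (B ℚ.* δ) (B ℚ.* δ) (0<* 0<B 0<δ)))))
    z≤B (≈⇒◇ x≈y δ 0<δ)

-- Ramps and time slots.

fromℚ-mono-≤ : ∀ {p q} → p ℚ.≤ q → fromℚ p ≤ fromℚ q
fromℚ-mono-≤ {p} {q} p≤q = always⇒≤ {fromℚ p} {fromℚ q} λ _ → p≤q

-- The fraction of a leg covered by time `t` if it is traversed during [o, o + 1]. Clamping each
-- term defines it at every real without comparing `t` with `o`, and nonexpansiveness preserves the
-- Cauchy modulus.
ramp : ℚ → ℝ → ℝ
ramp o t = mkℝ (λ n → clamp (seq t n ℚ.- o)) λ ε 0<ε → shrinks ε (cauchy t ε 0<ε)
  where
  shrinks : ∀ ε → ∃[ N ] (∀ m n → N ℕ.≤ m → N ℕ.≤ n → ℚ.∣ seq t m ℚ.- seq t n ∣ ℚ.< ε) →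
    ∃[ N ] (∀ m n → N ℕ.≤ m → N ℕ.≤ n → ℚ.∣ clamp (seq t m ℚ.- o) ℚ.- clamp (seq t n ℚ.- o) ∣ ℚ.< ε)
  shrinks ε (N , h) = N , λ m n N≤m N≤n → ℚₚ.≤-<-trans (clamp-shift-nonexpansive o (seq t m) (seq t n)) (h m n N≤m N≤n)

0≤ramp : ∀ o t → 0ℝ ≤ ramp o t
0≤ramp o t = always⇒≤ {0ℝ} {ramp o t} λ n → 0≤clamp (seq t n ℚ.- o)

ramp≤1 : ∀ o t → ramp o t ≤ 1ℝ
ramp≤1 o t = always⇒≤ {ramp o t} {1ℝ} λ n → clamp≤1 (seq t n ℚ.- o)

ramp-cong : ∀ o {s t} → s ≈ t → ramp o s ≈ ramp o t
ramp-cong o {s} {t} s≈t = ◇⇒≈ λ ε 0<ε →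
  ◇-map (λ n → ℚₚ.≤-trans (clamp-shift-nonexpansive o (seq s n) (seq t n))) (≈⇒◇ s≈t ε 0<ε)

ramp≈0 : ∀ o t → t ≤ fromℚ o → ramp o t ≈ 0ℝ
ramp≈0 o t t≤o = ◇⇒≈ λ ε 0<ε → ◇-map
  (λ n h → ∣p∣≤
    (by (clamp-≤ {seq t n ℚ.- o} (ℚₚ.<⇒≤ 0<ε) (by h (solve 3 (λ t o ε → t :- o :+ (o :+ ε) := ε :+ t) refl (seq t n) o ε)))
      (solve 2 (λ c ε → c :- con 0ℚ :+ ε := ε :+ c) refl (clamp (seq t n ℚ.- o)) ε))
    (by (0≤clamp (seq t n ℚ.- o) ⊕ ℚₚ.<⇒≤ 0<ε)
      (solve 2 (λ c ε → :- (c :- con 0ℚ) :+ (c :+ ε) := ε :+ (con 0ℚ :+ con 0ℚ)) refl (clamp (seq t n ℚ.- o)) ε)))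
  (≤⇒◇ {t} {fromℚ o} t≤o ε 0<ε)

ramp≈1 : ∀ o t → fromℚ (o ℚ.+ 1ℚ) ≤ t → ramp o t ≈ 1ℝ
ramp≈1 o t o+1≤t = ◇⇒≈ λ ε 0<ε → ◇-map
  (λ n h → ∣p∣≤
    (by (clamp≤1 (seq t n ℚ.- o) ⊕ ℚₚ.<⇒≤ 0<ε)
      (solve 2 (λ c ε → c :- con 1ℚ :+ (con 1ℚ :+ ε) := ε :+ (c :+ con 0ℚ)) refl (clamp (seq t n ℚ.- o)) ε))
    (by (clamp-≥ {seq t n ℚ.- o} {1ℚ ℚ.- ε}
          (by (ℚₚ.<⇒≤ 0<ε) (solve 1 (λ ε → con 1ℚ :- ε :+ ε := con 1ℚ :+ con 0ℚ) refl ε))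
          (by h (solve 3 (λ t o ε → con 1ℚ :- ε :+ (t :+ ε) := t :- o :+ (o :+ con 1ℚ)) refl (seq t n) o ε)))
      (solve 2 (λ c ε → :- (c :- con 1ℚ) :+ c := ε :+ (con 1ℚ :- ε)) refl (clamp (seq t n ℚ.- o)) ε)))
  (≤⇒◇ {fromℚ (o ℚ.+ 1ℚ)} {t} o+1≤t ε 0<ε)

≈⇒≤ : ∀ {x y} → x ≈ y → x ≤ y
≈⇒≤ {x} {y} x≈y = ◇⇒≤ {x} {y} λ ε 0<ε → ◇-map
  (λ n h → ℚₚ.≤-trans (p≤q+∣p-q∣ (seq x n) (seq y n)) (ℚₚ.+-monoʳ-≤ (seq y n) h)) (≈⇒◇ x≈y ε 0<ε)

≤-respˡ-≈ : ∀ {x y z} → x ≈ y → x ≤ z → y ≤ z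
≤-respˡ-≈ {x} {y} {z} x≈y = ≤-trans {y} {x} {z} (≈⇒≤ (≈-sym x≈y))

≤-respʳ-≈ : ∀ {z x y} → x ≈ y → z ≤ x → z ≤ y
≤-respʳ-≈ {z} {x} {y} x≈y z≤x = ≤-trans {z} {x} {y} z≤x (≈⇒≤ x≈y)

-- The witness depends on the representing sequence, so equal reals may receive different bounds;
-- `curve-cong` reconciles them.
time-bound : ∀ t → ∃[ k ] t ≤ fromℚ (double k)
time-bound t with bounded (cauchy t)
... | B , _ , N , ∣t∣≤B with archimedean B
... | k , B≤ = k , ◇⇒≤ {t} {fromℚ (double k)} λ ε 0<ε → N , λ n N≤n →
  ℚₚ.≤-trans (p≤∣p∣ (seq t n)) (ℚₚ.≤-trans (∣t∣≤B n N≤n) (ℚₚ.≤-trans B≤ (p≤p+q (double k) ε 0<ε)))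

double-mono : ∀ {m n} → m ≤′ n → double m ℚ.≤ double n
double-mono ≤′-refl           = ℚₚ.≤-refl
double-mono (≤′-step {n} m≤n) = ℚₚ.≤-trans (double-mono m≤n) (double-≤-suc n)

double-unbounded : ∀ B → ∃[ M ] (∀ m → M ℕ.≤ m → B < fromℚ (double m))
double-unbounded B with bounded (cauchy B)
... | b , _ , N , ∣B∣≤b with archimedean (b ℚ.+ 1ℚ)
... | M , b+1≤ = M , λ m M≤m → mk< 1ℚ (ℚₚ.positive⁻¹ 1ℚ) (N , λ n N≤n →
  ℚₚ.≤-trans (ℚₚ.+-monoˡ-≤ 1ℚ (ℚₚ.≤-trans (p≤∣p∣ (seq B n)) (∣B∣≤b n N≤n)))
    (ℚₚ.≤-trans b+1≤ (double-mono (ℕₚ.≤⇒≤′ M≤m))))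

-- The slot of `t` exists only under a double negation. The search descends from the bound `k`,
-- splitting at each boundary by `≤-total-¬¬`.
locate : ∀ t k → 0ℝ ≤ t → t ≤ fromℚ (double k) →
  ¬ (∀ m → ¬ Between (fromℚ (double m)) (fromℚ (double (suc m))) t)
locate t zero    0≤t t≤0  none = none 0 (0≤t , ≤-trans {t} {0ℝ} {fromℚ (double 1)} t≤0 (fromℚ-mono-≤ (0≤double 1)))
locate t (suc k) 0≤t t≤2k none = ≤-total-¬¬ t (fromℚ (double k))
  (λ t≤ → locate t k 0≤t t≤ none)
  (λ ≤t → none k (≤t , t≤2k))

-- The m-th leg is traversed during [o m, o m + 1], inside the time slot [2m, 2m+2].
module Polyline
  (a u : ℕ → ℝ) (step : ∀ m → a (suc m) ≡ a m + u m)
  (o : ℕ → ℚ) (starts-after : ∀ m → double m ℚ.≤ o m)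
  (ends-before : ∀ m → o m ℚ.+ 1ℚ ℚ.≤ double (suc m))
  where

  leg : ℕ → ℝ → ℝ
  leg m t = a m + ramp (o m) t * u m

  partial : ℕ → ℝ → ℝ
  partial zero    t = a 0
  partial (suc m) t = partial m t + ramp (o m) t * u m

  -- Summing up to the chosen bound instead of locating t keeps the definition
  -- constructive: every later summand vanishes at t.
  curve : ℝ → ℝ
  curve t = partial (proj₁ (time-bound t)) t

  x+ry≈x : ∀ {x r y} → r ≈ 0ℝ → x + r * y ≈ x
  x+ry≈x {x} {r} {y} r≈0 = ≈-trans (+-cong (≈-refl {x}) (*-congʳ y r≈0))
    (≗⇒≈ λ n → solve 2 (λ x y → x :+ con 0ℚ :* y := x) refl (seq x n) (seq y n))

  x+ry≈x+y : ∀ {x r y} → r ≈ 1ℝ → x + r * y ≈ x + y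
  x+ry≈x+y {x} {r} {y} r≈1 = ≈-trans (+-cong (≈-refl {x}) (*-congʳ y r≈1))
    (≗⇒≈ λ n → solve 2 (λ x y → x :+ con 1ℚ :* y := x :+ y) refl (seq x n) (seq y n))

  leg≈vertex : ∀ m t → t ≤ fromℚ (o m) → leg m t ≈ a m
  leg≈vertex m t t≤o = x+ry≈x (ramp≈0 (o m) t t≤o)

  leg≈next-vertex : ∀ m t → fromℚ (o m ℚ.+ 1ℚ) ≤ t → leg m t ≈ a (suc m)
  leg≈next-vertex m t o+1≤t = subst (leg m t ≈_) (sym (step m)) (x+ry≈x+y (ramp≈1 (o m) t o+1≤t))

  partial-cong : ∀ m {s t} → s ≈ t → partial m s ≈ partial m t
  partial-cong zero    s≈t = ≈-refl
  partial-cong (suc m) s≈t = +-cong (partial-cong m s≈t) (*-congʳ (u m) (ramp-cong (o m) s≈t))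

  -- Each extra summand belongs to a leg that starts no earlier than 2m, so its ramp is still 0 at
  -- `t`.
  partial-stable : ∀ {m n} → m ≤′ n → ∀ t → t ≤ fromℚ (double m) → partial n t ≈ partial m t
  partial-stable ≤′-refl t _ = ≈-refl
  partial-stable {m} (≤′-step {n} m≤n) t t≤2m = ≈-trans
    (x+ry≈x (ramp≈0 (o n) t (≤-trans {t} {fromℚ (double m)} {fromℚ (o n)} t≤2m
      (fromℚ-mono-≤ (ℚₚ.≤-trans (double-mono m≤n) (starts-after n))))))
    (partial-stable m≤n t t≤2m)

  -- All ramps in the sum have reached 1, so the full vectors add up along the route.
  partial≈vertex : ∀ m t → fromℚ (double m) ≤ t → partial m t ≈ a m
  partial≈vertex zero    t _      = ≈-refl
  partial≈vertex (suc m) t 2m+2≤t = subst (partial (suc m) t ≈_) (sym (step m))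
    (≈-trans (x+ry≈x+y (ramp≈1 (o m) t (after (ends-before m))))
      (+-cong (partial≈vertex m t (after (double-≤-suc m))) ≈-refl))
    where
    after : ∀ {q} → q ℚ.≤ double (suc m) → fromℚ q ≤ t
    after {q} q≤ = ≤-trans {fromℚ q} {fromℚ (double (suc m))} {t} (fromℚ-mono-≤ q≤) 2m+2≤t

  partial-agree : ∀ m n t → t ≤ fromℚ (double m) → t ≤ fromℚ (double n) → partial m t ≈ partial n t
  partial-agree m n t t≤2m t≤2n with ℕₚ.≤-total m n
  ... | inj₁ m≤n = ≈-sym (partial-stable (ℕₚ.≤⇒≤′ m≤n) t t≤2m)
  ... | inj₂ n≤m = partial-stable (ℕₚ.≤⇒≤′ n≤m) t t≤2n

  curve≈partial : ∀ m t → t ≤ fromℚ (double m) → curve t ≈ partial m t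
  curve≈partial m t t≤2m = partial-agree (proj₁ (time-bound t)) m t (proj₂ (time-bound t)) t≤2m

  -- The bound chosen for `s` is also valid for `t`, so both values can be read from the same
  -- partial sum.
  curve-cong : ∀ s t → s ≈ t → curve s ≈ curve t
  curve-cong s t s≈t = ≈-trans (partial-cong k s≈t)
    (≈-sym (curve≈partial k t (≤-respˡ-≈ {s} {t} {fromℚ (double k)} s≈t (proj₂ (time-bound s)))))
    where
    k = proj₁ (time-bound s)

  curve≈leg : ∀ m t → Between (fromℚ (double m)) (fromℚ (double (suc m))) t → curve t ≈ leg m t
  curve≈leg m t (2m≤t , t≤2m+2) = ≈-trans (curve≈partial (suc m) t t≤2m+2)
    (+-cong (partial≈vertex m t 2m≤t) ≈-refl)

  -- The distance of the two values is at most Bδ. The second Bδ in the hypothesis supplies the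
  -- positive rational gap that `_<_` asks for.
  leg-lipschitz : ∀ m {s t B δ ε} → 0ℚ ℚ.< B → 0ℚ ℚ.< δ → ◇ (λ n → ℚ.∣ seq (u m) n ∣ ℚ.≤ B) →
    ◇ (λ n → B ℚ.* δ ℚ.+ B ℚ.* δ ℚ.≤ seq ε n) → ∣ s - t ∣ < fromℚ δ → ∣ leg m s - leg m t ∣ < ε
  leg-lipschitz m {s} {t} {B} {δ} {ε} 0<B 0<δ u≤B 2Bδ≤ε (mk< gap 0<gap sep) =
    mk< (B ℚ.* δ) (0<* 0<B 0<δ) (◇-zip (λ n (u≤B , 2Bδ≤ε) near →
      ℚₚ.≤-trans (ℚₚ.+-monoˡ-≤ (B ℚ.* δ) (bound n u≤B (ℚₚ.≤-trans (p≤p+q _ gap 0<gap) near))) 2Bδ≤ε)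
      (u≤B ∧ 2Bδ≤ε) sep)
    where
    bound : ∀ n → ℚ.∣ seq (u m) n ∣ ℚ.≤ B → ℚ.∣ seq s n ℚ.- seq t n ∣ ℚ.≤ δ →
      ℚ.∣ seq (leg m s) n ℚ.- seq (leg m t) n ∣ ℚ.≤ B ℚ.* δ
    bound n u≤B near = subst (λ z → ℚ.∣ z ∣ ℚ.≤ B ℚ.* δ)
      (solve 4 (λ a r q u → u :* (r :- q) := a :+ r :* u :- (a :+ q :* u)) refl
        (seq (a m) n) (seq (ramp (o m) s) n) (seq (ramp (o m) t) n) (seq (u m) n))
      (∣p*q∣≤ (seq (u m) n) _ u≤B (ℚₚ.≤-trans (clamp-shift-nonexpansive (o m) (seq s n) (seq t n)) near))

-- Walks in the plane, one polyline per coordinate.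

module Walk
  (a : Route) (u : ℕ → ℝ²) (step : ∀ m → a (suc m) ≡ a m +² u m)
  (o : ℕ → ℚ) (starts-after : ∀ m → double m ℚ.≤ o m)
  (ends-before : ∀ m → o m ℚ.+ 1ℚ ℚ.≤ double (suc m))
  where

  module X = Polyline (λ m → xco (a m)) (λ m → xco (u m)) (λ m → cong xco (step m)) o starts-after ends-before
  module Y = Polyline (λ m → yco (a m)) (λ m → yco (u m)) (λ m → cong yco (step m)) o starts-after ends-before

  walk : ℝ≥0 → ℝ²
  walk (t , _) = ⟨ X.curve t , Y.curve t ⟩

  leg : ℕ → ℝ → ℝ²
  leg m t = ⟨ X.leg m t , Y.leg m t ⟩

  leg-continuous : ∀ m → Continuous (Between (fromℚ (double m)) (fromℚ (double (suc m)))) (λ t → leg m (proj₁ t))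
  leg-continuous m (t , _) ε (mk< gap 0<gap gap≤ε) = modulus (bounded (cauchy (xco (u m)))) (bounded (cauchy (yco (u m))))
    where
    Bound : ℝ → Set
    Bound x = ∃[ B ] 0ℚ ℚ.< B × ◇ (λ n → ℚ.∣ seq x n ∣ ℚ.≤ B)

    Modulus : ℝ → Set
    Modulus δ = ∀ (s : ∃ (Between (fromℚ (double m)) (fromℚ (double (suc m))))) → ∣ proj₁ s - t ∣ < δ →
        ∣ X.leg m (proj₁ s) - X.leg m t ∣ < ε × ∣ Y.leg m (proj₁ s) - Y.leg m t ∣ < ε

    modulus : Bound (xco (u m)) → Bound (yco (u m)) → ∃[ δ ] 0ℝ < δ × Modulus δ
    modulus (Bx , 0<Bx , ux≤) (By , 0<By , uy≤) = from-δ (shrink B gap 0<B 0<gap)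
      where
      -- The sum bounds both coordinates of the vector, so a single δ serves both.
      B = Bx ℚ.+ By
      0<B : 0ℚ ℚ.< B
      0<B = ℚₚ.+-mono-< {0ℚ} {Bx} {0ℚ} {By} 0<Bx 0<By
      from-δ : ∃[ δ ] 0ℚ ℚ.< δ × B ℚ.* δ ℚ.+ B ℚ.* δ ≡ gap → ∃[ δ ] 0ℝ < δ × Modulus δ
      from-δ (δ , 0<δ , 2Bδ≡gap) = fromℚ δ , mk< δ 0<δ (◇-always λ _ → ℚₚ.≤-reflexive (ℚₚ.+-identityˡ δ)) , λ s near →
          X.leg-lipschitz m {proj₁ s} {t} {B} {δ} {ε} 0<B 0<δ (◇-map (λ n h → ℚₚ.≤-trans h (p≤p+q Bx By 0<By)) ux≤) 2Bδ≤ε near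
        , Y.leg-lipschitz m {proj₁ s} {t} {B} {δ} {ε} 0<B 0<δ (◇-map (λ n h → ℚₚ.≤-trans h (q≤p+q Bx By 0<Bx)) uy≤) 2Bδ≤ε near
        where
        2Bδ≤ε : ◇ (λ n → B ℚ.* δ ℚ.+ B ℚ.* δ ℚ.≤ seq ε n)
        2Bδ≤ε = ◇-map (λ n → subst (ℚ._≤ seq ε n) (trans (ℚₚ.+-identityˡ gap) (sym 2Bδ≡gap))) gap≤ε

  leg-inSegment : ∀ m t → leg m t ∈[ a m , a (suc m) ]
  leg-inSegment m t = ramp (o m) t , 0≤ramp (o m) t , ramp≤1 (o m) t ,
    subst (λ b → leg m t ≈² a m +² ramp (o m) t · (b -² a m)) (sym (step m))
      ( ≗⇒≈ (λ n → cancel (seq (xco (a m)) n) (seq (ramp (o m) t) n) (seq (xco (u m)) n))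
      , ≗⇒≈ (λ n → cancel (seq (yco (a m)) n) (seq (ramp (o m) t) n) (seq (yco (u m)) n)))
    where
    cancel : ∀ a r u → a ℚ.+ r ℚ.* u ≡ a ℚ.+ r ℚ.* (a ℚ.+ u ℚ.- a)
    cancel = solve 3 (λ a r u → a :+ r :* u := a :+ r :* (a :+ u :- a)) refl

  isWalk : IsWalk a walk
  isWalk = record
    { cong-f     = λ (s , _) (t , _) s≈t → X.curve-cong s t s≈t , Y.curve-cong s t s≈t
    ; time       = λ m → fromℚ (double m)
    ; starts     = ≈-refl
    ; increasing = λ m → mk< (1ℚ ℚ.+ 1ℚ) (ℚₚ.positive⁻¹ (1ℚ ℚ.+ 1ℚ))
        (◇-always λ _ → ℚₚ.≤-reflexive (sym (ℚₚ.+-assoc (double m) 1ℚ 1ℚ)))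
    ; unbounded  = double-unbounded
    ; piece      = λ m t → leg m (proj₁ t)
    ; continuous = leg-continuous
    ; inSegment  = λ m t → leg-inSegment m (proj₁ t)
    ; atStart    = λ m (t , _) t≈2m →
        let t≤o = ≤-respˡ-≈ {fromℚ (double m)} {t} {fromℚ (o m)} (≈-sym t≈2m) (fromℚ-mono-≤ (starts-after m))
        in X.leg≈vertex m t t≤o , Y.leg≈vertex m t t≤o
    ; atEnd      = λ m (t , _) t≈2m+2 →
        let o+1≤t = ≤-respʳ-≈ {fromℚ (o m ℚ.+ 1ℚ)} {fromℚ (double (suc m))} {t} (≈-sym t≈2m+2) (fromℚ-mono-≤ (ends-before m))
        in X.leg≈next-vertex m t o+1≤t , Y.leg≈next-vertex m t o+1≤t
    ; glue       = λ m t _ t∈ → X.curve≈leg m t t∈ , Y.curve≈leg m t t∈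
    }

-- A point off countably many segments.

Segment : Set
Segment = ℝ² × ℝ²

infix 4 _avoids_

_avoids_ : ℝ² → Segment → Set
d avoids (p , u) = ∀ s → 0ℝ ≤ s → s ≤ 1ℝ → d ≉² p +² s · u

-- The centre moves by at most ½r and the new radius is ¼r, so the new box stays inside the old one.
-- Every real point that eventually lies in the new box is off the segment.
Dodge : Segment → ℚ → ℚ → ℚ → Set
Dodge S cx cy r = ∃[ cx′ ] ∃[ cy′ ]
  ℚ.∣ cx′ ℚ.- cx ∣ ℚ.≤ ½ ℚ.* r × ℚ.∣ cy′ ℚ.- cy ∣ ℚ.≤ ½ ℚ.* r ×
  (∀ d → ◇ (λ n → ℚ.∣ seq (xco d) n ℚ.- cx′ ∣ ℚ.≤ ¼ ℚ.* r) → ◇ (λ n → ℚ.∣ seq (yco d) n ℚ.- cy′ ∣ ℚ.≤ ¼ ℚ.* r) →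
    d avoids S)

dodge-segment : ∀ S cx cy r → 0ℚ ℚ.< r → Dodge S cx cy r
dodge-segment (p , u) cx cy r 0<r =
  let px , px≈ = approximation (xco p) η 0<η
      py , py≈ = approximation (yco p) η 0<η
      ux , ux≈ = approximation (xco u) η 0<η
      uy , uy≈ = approximation (yco u) η 0<η
      cx′ , cy′ , cx′≈ , cy′≈ , apart = dodge px py ux uy cx cy r 0<r
  in cx′ , cy′ , cx′≈ , cy′≈ , λ d dx≈ dy≈ s 0≤s s≤1 (x≈ , y≈) →
    -- All eventual estimates hold together at some index, where the claim is about rationals only
    -- and `dodge` applies.
    let n , (s≤2 , hx , hy , (hpx , hux) , (hpy , huy) , hdx , hdy) = ◇-now
          (∣s∣≤2 s 0≤s s≤1 ∧ dx≈ ∧ dy≈ ∧ (px≈ ∧ ux≈) ∧ (py≈ ∧ uy≈) ∧ ≈⇒◇ x≈ η 0<η ∧ ≈⇒◇ y≈ η 0<η)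
    in apart (seq (xco d) n) (seq (yco d) n) (seq s n) hx hy
        (on-line (seq (xco d) n) (seq (xco p) n) (seq s n) (seq (xco u) n) px ux hdx hpx s≤2 hux)
        (on-line (seq (yco d) n) (seq (yco p) n) (seq s n) (seq (yco u) n) py uy hdy hpy s≤2 huy)
  where
  -- The four errors of `near-line` then add up to ⅛r, the tolerance of `dodge`.
  η = ¹/₃₂ ℚ.* r
  0<η : 0ℚ ℚ.< η
  0<η = 0<* (ℚₚ.positive⁻¹ ¹/₃₂) 0<r

  on-line : ∀ x p s u p′ u′ → ℚ.∣ x ℚ.- (p ℚ.+ s ℚ.* u) ∣ ℚ.≤ η → ℚ.∣ p ℚ.- p′ ∣ ℚ.≤ η →
    ℚ.∣ s ∣ ℚ.≤ 1ℚ ℚ.+ 1ℚ → ℚ.∣ u ℚ.- u′ ∣ ℚ.≤ η → ℚ.∣ x ℚ.- (p′ ℚ.+ s ℚ.* u′) ∣ ℚ.≤ ½ ℚ.* (¼ ℚ.* r)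
  on-line x p s u p′ u′ x≈ p≈ s≤2 u≈ = subst (ℚ.∣ x ℚ.- (p′ ℚ.+ s ℚ.* u′) ∣ ℚ.≤_)
    (solve 1 (λ r → con ¹/₃₂ :* r :+ con ¹/₃₂ :* r :+ con ¹/₃₂ :* r :+ con ¹/₃₂ :* r := con ½ :* (con ¼ :* r)) refl r)
    (near-line x p s u p′ u′ x≈ p≈ s≤2 u≈)

  ∣s∣≤2 : ∀ s → 0ℝ ≤ s → s ≤ 1ℝ → ◇ (λ n → ℚ.∣ seq s n ∣ ℚ.≤ 1ℚ ℚ.+ 1ℚ)
  ∣s∣≤2 s 0≤s s≤1 = ◇-zip
    (λ n lower upper → ∣p∣≤ upper
      (by (lower ⊕ ℚₚ.nonNegative⁻¹ 1ℚ)
        (solve 1 (λ s → :- s :+ (s :+ con 1ℚ :+ con 1ℚ) := con 1ℚ :+ con 1ℚ :+ (con 0ℚ :+ con 0ℚ)) refl (seq s n))))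
    (≤⇒◇ {0ℝ} {s} 0≤s 1ℚ (ℚₚ.positive⁻¹ 1ℚ)) (≤⇒◇ {s} {1ℝ} s≤1 1ℚ (ℚₚ.positive⁻¹ 1ℚ))

module _ (c : ℕ → ℚ) (c-step : ∀ k → ℚ.∣ c (suc k) ℚ.- c k ∣ ℚ.≤ ½ ℚ.* radius k) where

  -- The n-th box lies inside the k-th. One more step moves the centre by ½ and leaves radius ¼ of
  -- `radius n`, which fits with ¼ to spare.
  nested : ∀ {k n} → k ≤′ n → ℚ.∣ c n ℚ.- c k ∣ ℚ.+ radius n ℚ.≤ radius k
  nested {k} ≤′-refl = ℚₚ.≤-reflexive (trans
    (cong (λ z → ℚ.∣ z ∣ ℚ.+ radius k) (ℚₚ.+-inverseʳ (c k))) (ℚₚ.+-identityˡ (radius k)))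
  nested {k} (≤′-step {n} k≤n) =
    by (triangle (c (suc n)) (c n) (c k) ⊕ c-step n ⊕ nested k≤n ⊕ ℚₚ.<⇒≤ (0<¼* (0<radius n)))
      (solve 5 (λ x y z r R → x :+ con ¼ :* r :+ (y :+ z :+ con ½ :* r :+ R :+ con ¼ :* r)
        := R :+ (x :+ y :+ (z :+ r) :+ con 0ℚ)) refl
        ℚ.∣ c (suc n) ℚ.- c k ∣ ℚ.∣ c (suc n) ℚ.- c n ∣ ℚ.∣ c n ℚ.- c k ∣ (radius n) (radius k))

  within-radius : ∀ {k n} → k ℕ.≤ n → ℚ.∣ c n ℚ.- c k ∣ ℚ.≤ radius k
  within-radius {k} {n} k≤n = ℚₚ.≤-trans (p≤p+q _ (radius n) (0<radius n)) (nested (ℕₚ.≤⇒≤′ k≤n))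

  nested-cauchy : Cauchy c
  nested-cauchy ε 0<ε = from-radius (radius-small (½ ℚ.* ε) (half-pos 0<ε))
    where
    from-radius : ∃[ k ] radius k ℚ.< ½ ℚ.* ε →
      ∃[ N ] (∀ m n → N ℕ.≤ m → N ℕ.≤ n → ℚ.∣ c m ℚ.- c n ∣ ℚ.< ε)
    from-radius (k , r<½ε) = k , λ m n k≤m k≤n → subst (ℚ.∣ c m ℚ.- c n ∣ ℚ.<_) (half+half ε)
      (ℚₚ.≤-<-trans {ℚ.∣ c m ℚ.- c n ∣} {radius k ℚ.+ radius k} {½ ℚ.* ε ℚ.+ ½ ℚ.* ε}
        (ℚₚ.≤-trans (triangle (c m) (c k) (c n))
          (within-radius k≤m ⊕ subst (ℚ._≤ radius k) (∣p-q∣≡∣q-p∣ (c n) (c k)) (within-radius k≤n)))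
        (ℚₚ.+-mono-< r<½ε r<½ε))

module _ (S : ℕ → Segment) where

  centre : ℕ → ℚ × ℚ

  next-centre : ∀ k → Dodge (S k) (proj₁ (centre k)) (proj₂ (centre k)) (radius k)
  next-centre k = dodge-segment (S k) (proj₁ (centre k)) (proj₂ (centre k)) (radius k) (0<radius k)

  centre zero    = 0ℚ , 0ℚ
  centre (suc k) = proj₁ (next-centre k) , proj₁ (proj₂ (next-centre k))

  generic-point : ∃[ d ] (∀ k → d avoids S k)
  generic-point = ⟨ mkℝ cx (nested-cauchy cx stepx) , mkℝ cy (nested-cauchy cy stepy) ⟩ , λ k →
    proj₂ (proj₂ (proj₂ (proj₂ (next-centre k)))) ⟨ mkℝ cx (nested-cauchy cx stepx) , mkℝ cy (nested-cauchy cy stepy) ⟩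
      -- The k-th segment is avoided by the box of index k + 1, whose radius is by definition ¼ of
      -- `radius k`; all later centres lie in it.
      (suc k , λ n → within-radius cx stepx) (suc k , λ n → within-radius cy stepy)
    where
    cx cy : ℕ → ℚ
    cx k = proj₁ (centre k)
    cy k = proj₂ (centre k)
    stepx : ∀ k → ℚ.∣ cx (suc k) ℚ.- cx k ∣ ℚ.≤ ½ ℚ.* radius k
    stepx k = proj₁ (proj₂ (proj₂ (next-centre k)))
    stepy : ∀ k → ℚ.∣ cy (suc k) ℚ.- cy k ∣ ℚ.≤ ½ ℚ.* radius k
    stepy k = proj₁ (proj₂ (proj₂ (proj₂ (next-centre k))))

interleave : {A : Set} → (ℕ → A) → (ℕ → A) → ℕ → A
interleave f g zero    = f zero
interleave f g (suc n) = interleave g (λ k → f (suc k)) n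

-- Two unfoldings of `interleave` restore the order of the arguments and drop the head of each, so
-- the index found is 2m.
interleave-left : ∀ {A : Set} (f g : ℕ → A) m → ∃[ n ] interleave f g n ≡ f m
interleave-left f g zero    = 0 , refl
interleave-left f g (suc m) with interleave-left (λ k → f (suc k)) (λ k → g (suc k)) m
... | n , eq = suc (suc n) , eq

interleave-right : ∀ {A : Set} (f g : ℕ → A) m → ∃[ n ] interleave f g n ≡ g m
interleave-right f g m with interleave-left g (λ k → f (suc k)) m
... | n , eq = suc n , eq

-- Abstract so that the nested boxes are never unfolded during typechecking.
abstract

  generic-point₂ : ∀ (S T : ℕ → Segment) → ∃[ d ] (∀ m → d avoids S m) × (∀ m → d avoids T m)
  generic-point₂ S T = d , avoids-at (interleave-left S T) , avoids-at (interleave-right S T)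
    where
    d : ℝ²
    d = proj₁ (generic-point (interleave S T))
    avoids-at : ∀ {U : ℕ → Segment} → (∀ m → ∃[ n ] interleave S T n ≡ U m) → ∀ m → d avoids U m
    avoids-at at m = subst (d avoids_) (proj₂ (at m)) (proj₂ (generic-point (interleave S T)) (proj₁ (at m)))

-- Translated routes and the offset at a meeting.

0² : ℝ²
0² = ⟨ 0ℝ , 0ℝ ⟩

≈-assoc-step : ∀ b d b₀ w → b ≈ d + b₀ → b + w ≈ d + (b₀ + w)
≈-assoc-step b d b₀ w b≈ = ≈-trans {b + w} {d + b₀ + w} {d + (b₀ + w)} (+-cong {b} {d + b₀} {w} {w} b≈ (≈-refl {w}))
  (≗⇒≈ {d + b₀ + w} {d + (b₀ + w)} λ n → ℚₚ.+-assoc (seq d n) (seq b₀ n) (seq w n))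

x≈x+0 : ∀ x → x ≈ x + 0ℝ
x≈x+0 x = ≗⇒≈ {x} {x + 0ℝ} λ n → sym (ℚₚ.+-identityʳ (seq x n))

route-translate : ∀ 𝒜 ℓ d m → route 𝒜 ℓ d m ≈² d +² route 𝒜 ℓ 0² m
route-translate 𝒜 ℓ d zero    = x≈x+0 (xco d) , x≈x+0 (yco d)
route-translate 𝒜 ℓ d (suc m) =
    ≈-assoc-step (xco (route 𝒜 ℓ d m)) (xco d) (xco (route 𝒜 ℓ 0² m)) (xco (𝒜 ℓ m)) (proj₁ (route-translate 𝒜 ℓ d m))
  , ≈-assoc-step (yco (route 𝒜 ℓ d m)) (yco d) (yco (route 𝒜 ℓ 0² m)) (yco (𝒜 ℓ m)) (proj₂ (route-translate 𝒜 ℓ d m))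

-- The counterpart of `by` for equality of reals: the two equations need only have termwise equal
-- differences.
≈-by : ∀ {x y z w} → x ≈ y → (∀ n → seq z n ℚ.- seq w n ≡ seq x n ℚ.- seq y n) → z ≈ w
≈-by x≈y h = ◇⇒≈ λ ε 0<ε → ◇-map (λ n → subst (λ z → ℚ.∣ z ∣ ℚ.≤ ε) (sym (h n))) (≈⇒◇ x≈y ε 0<ε)

-- The first agent rests at `a` while the second is on its leg from `b`. The moving vector changes
-- sign when the equation is solved for `d`.
solve-offset-resting : ∀ a b b₀ d s w → b ≈ d + b₀ → a ≈ b + s * w → d ≈ a - b₀ + s * - w
solve-offset-resting a b b₀ d s w b≈ a≈ = ≈-by (≈-sym (≈-trans a≈ (+-cong b≈ ≈-refl))) λ n →
  solve 5 (λ a b₀ d s w → d :- (a :- b₀ :+ s :* :- w) := d :+ b₀ :+ s :* w :- a) refl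
    (seq a n) (seq b₀ n) (seq d n) (seq s n) (seq w n)

solve-offset-moving : ∀ a b b₀ d s u → b ≈ d + b₀ → a + s * u ≈ b → d ≈ a - b₀ + s * u
solve-offset-moving a b b₀ d s u b≈ b≈a = ≈-by (≈-sym (≈-trans b≈a b≈)) λ n →
  solve 5 (λ a b₀ d s u → d :- (a :- b₀ :+ s :* u) := d :+ b₀ :- (a :+ s :* u)) refl
    (seq a n) (seq b₀ n) (seq d n) (seq s n) (seq u n)

-- The two walks and the absence of a meeting.

module NoMeeting (𝒜 : Algorithm) (ℓ₁ ℓ₂ : Label) where

  a b₀ : Route
  a  = route 𝒜 ℓ₁ 0²
  b₀ = route 𝒜 ℓ₂ 0²

  S T : ℕ → Segment
  -- These are the offsets that allow a meeting in the first half of slot m. For `T`, in the second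
  -- half, the second agent has already moved on to its vertex of index m + 1.
  S m = a m -² b₀ m , ⟨ - xco (𝒜 ℓ₂ m) , - yco (𝒜 ℓ₂ m) ⟩
  T m = a m -² b₀ (suc m) , 𝒜 ℓ₁ m

  offset : ∃[ d ] (∀ m → d avoids S m) × (∀ m → d avoids T m)
  offset = generic-point₂ S T

  d : ℝ²
  d = proj₁ offset

  b : Route
  b = route 𝒜 ℓ₂ d

  -- The leg of the first agent fills the second half of each slot, and that of the second agent, in
  -- `G`, the first half.
  module F = Walk a (𝒜 ℓ₁) (λ _ → refl) (λ m → double m ℚ.+ 1ℚ)
    (λ m → p≤p+q (double m) 1ℚ (ℚₚ.positive⁻¹ 1ℚ)) (λ _ → ℚₚ.≤-refl)
  module G = Walk b (𝒜 ℓ₂) (λ _ → refl) double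
    (λ _ → ℚₚ.≤-refl) (λ m → p≤p+q (double m ℚ.+ 1ℚ) 1ℚ (ℚₚ.positive⁻¹ 1ℚ))

  -- In either half of the slot one agent rests at a vertex, so a meeting would put `d` on `S m` or
  -- on `T m`. The halves are separated under a double negation.
  legs-disjoint : ∀ m t → F.leg m t ≉² G.leg m t
  legs-disjoint m t (x≈ , y≈) = ≤-total-¬¬ t (fromℚ (double m ℚ.+ 1ℚ)) first-half second-half
    where
    first-half : ¬ (t ≤ fromℚ (double m ℚ.+ 1ℚ))
    first-half t≤ = proj₁ (proj₂ offset) m (ramp (double m) t) (0≤ramp (double m) t) (ramp≤1 (double m) t)
      ( solve-offset-resting (xco (a m)) (xco (b m)) (xco (b₀ m)) (xco d) (ramp (double m) t) (xco (𝒜 ℓ₂ m))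
          (proj₁ (route-translate 𝒜 ℓ₂ d m)) (≈-trans {xco (a m)} {F.X.leg m t} {G.X.leg m t} (≈-sym (F.X.leg≈vertex m t t≤)) x≈)
      , solve-offset-resting (yco (a m)) (yco (b m)) (yco (b₀ m)) (yco d) (ramp (double m) t) (yco (𝒜 ℓ₂ m))
          (proj₂ (route-translate 𝒜 ℓ₂ d m)) (≈-trans {yco (a m)} {F.Y.leg m t} {G.Y.leg m t} (≈-sym (F.Y.leg≈vertex m t t≤)) y≈))

    second-half : ¬ (fromℚ (double m ℚ.+ 1ℚ) ≤ t)
    second-half ≤t = proj₂ (proj₂ offset) m (ramp (double m ℚ.+ 1ℚ) t) (0≤ramp (double m ℚ.+ 1ℚ) t) (ramp≤1 (double m ℚ.+ 1ℚ) t) (x-offset , y-offset)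
      where
      x-meet : xco (a m) + ramp (double m ℚ.+ 1ℚ) t * xco (𝒜 ℓ₁ m) ≈ xco (b (suc m))
      x-meet = ≈-trans {F.X.leg m t} {G.X.leg m t} {xco (b (suc m))} x≈ (G.X.leg≈next-vertex m t ≤t)
      x-offset : xco d ≈ xco (a m) - xco (b₀ (suc m)) + ramp (double m ℚ.+ 1ℚ) t * xco (𝒜 ℓ₁ m)
      x-offset = solve-offset-moving (xco (a m)) (xco (b (suc m))) (xco (b₀ (suc m))) (xco d) (ramp (double m ℚ.+ 1ℚ) t) (xco (𝒜 ℓ₁ m))
        (proj₁ (route-translate 𝒜 ℓ₂ d (suc m))) x-meet
      y-meet : yco (a m) + ramp (double m ℚ.+ 1ℚ) t * yco (𝒜 ℓ₁ m) ≈ yco (b (suc m))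
      y-meet = ≈-trans {F.Y.leg m t} {G.Y.leg m t} {yco (b (suc m))} y≈ (G.Y.leg≈next-vertex m t ≤t)
      y-offset : yco d ≈ yco (a m) - yco (b₀ (suc m)) + ramp (double m ℚ.+ 1ℚ) t * yco (𝒜 ℓ₁ m)
      y-offset = solve-offset-moving (yco (a m)) (yco (b (suc m))) (yco (b₀ (suc m))) (yco d) (ramp (double m ℚ.+ 1ℚ) t) (yco (𝒜 ℓ₁ m))
        (proj₂ (route-translate 𝒜 ℓ₂ d (suc m))) y-meet

  walks-disjoint : ∀ t → F.walk t ≉² G.walk t
  walks-disjoint (t , 0≤t) (x≈ , y≈) = locate t (proj₁ (time-bound t)) 0≤t (proj₂ (time-bound t)) λ m t∈ →
    legs-disjoint m t
      ( ≈-trans {F.X.leg m t} {F.X.curve t} {G.X.leg m t} (≈-sym (F.X.curve≈leg m t t∈))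
          (≈-trans {F.X.curve t} {G.X.curve t} {G.X.leg m t} x≈ (G.X.curve≈leg m t t∈))
      , ≈-trans {F.Y.leg m t} {F.Y.curve t} {G.Y.leg m t} (≈-sym (F.Y.curve≈leg m t t∈))
          (≈-trans {F.Y.curve t} {G.Y.curve t} {G.Y.leg m t} y≈ (G.Y.curve≈leg m t t∈)))

  -- Both walks are at their starting points at time 0, so equal starts would already be a meeting.
  starts-differ : 0² ≉² d
  starts-differ (x≈ , y≈) = walks-disjoint (0ℝ , 0≤0)
    ( ≈-trans (F.X.curve≈partial 0 0ℝ 0≤0) (≈-trans x≈ (≈-sym (G.X.curve≈partial 0 0ℝ 0≤0)))
    , ≈-trans (F.Y.curve≈partial 0 0ℝ 0≤0) (≈-trans y≈ (≈-sym (G.Y.curve≈partial 0 0ℝ 0≤0))))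
    where
    0≤0 : 0ℝ ≤ 0ℝ
    0≤0 = always⇒≤ {0ℝ} {0ℝ} λ _ → ℚₚ.≤-refl

proposition4p1 : (𝒜 : Algorithm) →
    ∃[ ℓ₁ ] ∃[ ℓ₂ ] ∃[ v ] ∃[ w ] ∃[ f ] ∃[ g ]
    ℓ₁ ≢ ℓ₂ × v ≉² w ×
    IsWalk (route 𝒜 ℓ₁ v) f × IsWalk (route 𝒜 ℓ₂ w) g ×
    (∀ t → f t ≉² g t)
proposition4p1 𝒜 = one , two , 0² , d , F.walk , G.walk ,
  (λ ()) , starts-differ , F.isWalk , G.isWalk , walks-disjoint
  where
  one two : Label
  one = 1 ,ᵣ [ ℕ.s≤s ℕ.z≤n ]
  two = 2 ,ᵣ [ ℕ.s≤s ℕ.z≤n ]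
  open NoMeeting 𝒜 one two
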